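{- Let $A$ be adequate, $N\in A$, and suppose that $A$ is $N$-closed, i.e. for all $M\in A$, if $M\cap\beta_{M,N}\in Sk(N)$ then $M\cap\beta_{M,N}\in A$. Let $B$ be adequate such that $A\cap Sk(N)\subseteq B\subseteq Sk(N)$. Then $A\cup B$ is adequate.
   Context: Standing assumptions and notation. Assume $2^{\omega_1}=\omega_2$ and fix a bijection $\pi:\omega_2\to H(\omega_2)$. $P_{\omega_1}(\omega_2)$ is the set of countable subsets of $\omega_2$. Assume there is a stationary set $\mathcal{Y}\subseteq P_{\omega_1}(\omega_2)$ which is thin, i.e. for all $\beta<\omega_2$ the set $\{a\cap\beta: a\in\mathcal{Y}\}$ has size at most $\omega_1$; fix such a $\mathcal{Y}$ which is moreover closed under initial segments ($a\in\mathcal{Y}$, $\beta<\omega_2$ imply $a\cap\beta\in\mathcal{Y}$). Let $\mathcal{A}$ be the structure $(H(\omega_2),\in,\pi,\mathcal{Y})$, which has definable Skolem functions (via the well-ordering induced by $\pi$). For $a\subseteq H(\omega_2)$, $Sk(a)$ is the closure of $a$ under a fixed set of definable Skolem functions for $\mathcal{A}$. Let $C$ be the (club) set of $\beta<\omega_2$ with $Sk(\beta)\cap\omega_2=\beta$, and let $\Lambda$ be the set of $\beta<\omega_2$ of cofinality $\omega_1$ which are limit points of $C$. Let $\mathcal{X}$ be the set of $M\in\mathcal{Y}$ such that $Sk(M)\cap\omega_2=M$ and for all $\gamma\in M$, $\sup(C\cap\gamma)\in M$. Comparison points and adequacy. Fix a set $\Gamma\subseteq\Lambda$ which is stationary in $\omega_2$.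 For $M\in\mathcal{X}$, $\Gamma_M$ is the set of $\beta\in\Gamma$ such that $\beta=\min(\Gamma\setminus\sup(M\cap\beta))$, i.e. $\Gamma\cap[\sup(M\cap\beta),\beta)=\emptyset$. For $M,N\in\mathcal{X}$, $\Gamma_M\cap\Gamma_N$ has a largest element, denoted $\beta_{M,N}$. A set $A\subseteq\mathcal{X}$ is adequate if for all $M,N\in A$, either $M\cap\beta_{M,N}=N\cap\beta_{M,N}$, or $M\cap\beta_{M,N}\in Sk(N)$, or $N\cap\beta_{M,N}\in Sk(M)$. -}

module Defs where

open import Data.Fin using (Fin)
open import Data.Nat using (ℕ; suc)
open import Data.Product using (Σ; ∃-syntax; _×_; _,_; proj₁; proj₂)
open import Data.Sum using (_⊎_; [_,_]′)
open import Data.Vec.Functional using (Vector; _∷_)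
open import Function using (_∘_)
open import Function.Bundles using (Func; Injection; Bijection; _⇔_)
open import Level using (Lift; 0ℓ; _⊔_) renaming (suc to lsuc)
open import Relation.Binary.Bundles using (Setoid)
open import Relation.Binary.Construct.Closure.Transitive using (TransClosure)
import Relation.Binary.Construct.On as On
import Relation.Binary.PropositionalEquality as ≡
open import Relation.Nullary using (¬_)

-- The universe of sets: well-founded trees (Aczel), with extensional equality.
-- Under excluded middle it satisfies the axioms of ZF.

data V : Set₁ where
  set : (I : Set) → (I → V) → V

Index : V → Set
Index (set I f) = I

elem : (x : V) → Index x → V
elem (set I f) = f

infix 4 _≈_ _∈_ _⊆_ _≤_
infixr 7 _∩_
infixr 6 _∪_

_≈_ : V → V → Set
set I f ≈ set J g = (∀ i → ∃[ j ] f i ≈ g j) × (∀ j → ∃[ i ] f i ≈ g j)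

_∈_ : V → V → Set
x ∈ y = ∃[ j ] x ≈ elem y j

_⊆_ : V → V → Set₁
x ⊆ y = ∀ z → z ∈ x → z ∈ y

≈-refl : ∀ x → x ≈ x
≈-refl (set I f) = (λ i → i , ≈-refl (f i)) , (λ i → i , ≈-refl (f i))

≈-sym : ∀ x y → x ≈ y → y ≈ x
≈-sym (set I f) (set J g) (p , q) =
  (λ j → proj₁ (q j) , ≈-sym (f _) (g j) (proj₂ (q j))) ,
  (λ i → proj₁ (p i) , ≈-sym (f i) (g _) (proj₂ (p i)))

≈-trans : ∀ x y z → x ≈ y → y ≈ z → x ≈ z
≈-trans (set I f) (set J g) (set K h) (p , q) (r , s) =
  (λ i → proj₁ (r (proj₁ (p i))) ,
         ≈-trans (f i) (g _) (h _) (proj₂ (p i)) (proj₂ (r _))) ,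
  (λ k → proj₁ (q (proj₁ (s k))) ,
         ≈-trans (f _) (g _) (h k) (proj₂ (q _)) (proj₂ (s k)))

V-setoid : Setoid (lsuc 0ℓ) 0ℓ
V-setoid = record
  { Carrier = V
  ; _≈_ = _≈_
  ; isEquivalence = record
    { refl  = λ {x} → ≈-refl x
    ; sym   = λ {x} {y} → ≈-sym x y
    ; trans = λ {x} {y} {z} → ≈-trans x y z
    }
  }

_∩_ : V → V → V
set I f ∩ y = set (Σ I λ i → f i ∈ y) (f ∘ proj₁)

_∪_ : V → V → V
set I f ∪ set J g = set (I ⊎ J) [ f , g ]′

⋃ₙ : (ℕ → V) → V
⋃ₙ a = set (Σ ℕ (Index ∘ a)) (λ (n , i) → elem (a n) i)

-- A class regarded as a setoid. Functions between sets are setoid functions: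
-- they respect _≈_ and do not depend on the proof of membership.

⟦_⟧ : ∀ {ℓ} → (V → Set ℓ) → Setoid (lsuc 0ℓ ⊔ ℓ) 0ℓ
⟦ P ⟧ = On.setoid {B = Σ V P} V-setoid proj₁

-- Every set of nonempty sets has a choice function.
AxiomOfChoice : Set₁
AxiomOfChoice =
  ∀ x → (∀ y → y ∈ x → ∃[ z ] z ∈ y) →
  Σ (Func ⟦ _∈ x ⟧ V-setoid) λ f → ∀ y (y∈x : y ∈ x) → Func.to f (y , y∈x) ∈ y

-- Von Neumann ordinals: transitive sets of transitive sets (the membership
-- relation of V is well-founded). The ordering α < β is α ∈ β.

Transitive : V → Set₁
Transitive x = ∀ y → y ∈ x → y ⊆ x

IsOrd : V → Set₁
IsOrd α = Transitive α × (∀ β → β ∈ α → Transitive β)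

_≤_ : V → V → Set
α ≤ β = α ∈ β ⊎ α ≈ β

IsLeast : ∀ {ℓ} → (V → Set ℓ) → V → Set (lsuc 0ℓ ⊔ ℓ)
IsLeast P α = P α × (∀ β → P β → α ≤ β)

IsGreatest : ∀ {ℓ} → (V → Set ℓ) → V → Set (lsuc 0ℓ ⊔ ℓ)
IsGreatest P α = P α × (∀ β → P β → β ≤ α)

-- σ is the supremum of the class P of ordinals; sup ∅ = 0.
IsSup : ∀ {ℓ} → (V → Set ℓ) → V → Set (lsuc 0ℓ ⊔ ℓ)
IsSup P = IsLeast (λ τ → IsOrd τ × (∀ δ → P δ → δ ≤ τ))

LimitPoint : ∀ {ℓ} → (V → Set ℓ) → V → Set (lsuc 0ℓ ⊔ ℓ)
LimitPoint P β =
  (∃[ α ] α ∈ β) × (∀ α → α ∈ β → ∃[ γ ] P γ × α ∈ γ × γ ∈ β)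

CofinalMap : V → V → Set₁
CofinalMap κ β =
  Σ (Func ⟦ _∈ κ ⟧ ⟦ _∈ β ⟧) λ f →
  ∀ α → α ∈ β → ∃[ i ] α ≤ proj₁ (Func.to f i)

HasCofinality : V → V → Set₁
HasCofinality β = IsLeast (λ κ → IsOrd κ × CofinalMap κ β)

Countable : V → Set₁
Countable x = Injection ⟦ _∈ x ⟧ (≡.setoid ℕ)

-- κ is the least ordinal that does not inject into S: ω₁ for S = ℕ, and the
-- cardinal successor of S when S is an infinite cardinal.
IsNextCardinal : ∀ {a} → Setoid a 0ℓ → V → Set (lsuc 0ℓ ⊔ a)
IsNextCardinal S = IsLeast (λ α → IsOrd α × ¬ Injection ⟦ _∈ α ⟧ S)

-- H(κ), for κ a cardinal: the sets whose transitive closure has size < κ.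
H : V → V → Set₁
H κ x = ∃[ α ] α ∈ κ × Injection ⟦ (λ y → TransClosure _∈_ y x) ⟧ ⟦ _∈ α ⟧

Pω₁ : V → V → Set₁
Pω₁ x a = a ⊆ x × Countable a

IsClub : V → V → Set₁
IsClub κ E =
  E ⊆ κ ×
  (∀ α → α ∈ κ → ∃[ γ ] γ ∈ E × α ∈ γ) ×
  (∀ δ → δ ∈ κ → LimitPoint (_∈ E) δ → δ ∈ E)

IsStationary : V → V → Set₁
IsStationary κ Γ = ∀ E → IsClub κ E → ∃[ β ] β ∈ Γ × β ∈ E

IsClubPω₁ : V → V → Set₁
IsClubPω₁ x D =
  (∀ a → a ∈ D → Pω₁ x a) ×
  (∀ a → Pω₁ x a → ∃[ b ] b ∈ D × a ⊆ b) ×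
  (∀ (a : ℕ → V) → (∀ n → a n ∈ D) → (∀ n → a n ⊆ a (suc n)) → ⋃ₙ a ∈ D)

IsStationaryPω₁ : V → V → Set₁
IsStationaryPω₁ x S = ∀ D → IsClubPω₁ x D → ∃[ a ] a ∈ S × a ∈ D

record Setting : Set₁ where
  field
    ω₁ ω₂    : V
    isω₁     : IsNextCardinal (≡.setoid ℕ) ω₁
    isω₂     : IsNextCardinal ⟦ _∈ ω₁ ⟧ ω₂
    2^ω₁≡ω₂  : Bijection ⟦ _⊆ ω₁ ⟧ ⟦ _∈ ω₂ ⟧
    π        : Bijection ⟦ _∈ ω₂ ⟧ ⟦ H ω₂ ⟧
    𝒴        : V
    𝒴⊆Pω₁ω₂  : ∀ a → a ∈ 𝒴 → Pω₁ ω₂ a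
    𝒴-stat   : IsStationaryPω₁ ω₂ 𝒴
    𝒴-thin   : ∀ β → β ∈ ω₂ →
               Injection ⟦ (λ x → ∃[ a ] a ∈ 𝒴 × x ≈ a ∩ β) ⟧ ⟦ _∈ ω₁ ⟧
    𝒴-closed : ∀ a β → a ∈ 𝒴 → β ∈ ω₂ → a ∩ β ∈ 𝒴

-- First-order formulas in the language of (H(ω₂), ∈, π, 𝒴), with n free
-- variables (de Bruijn). The symbol for π is the binary relation π(α) = x.

data Formula (n : ℕ) : Set where
  _∈'_ _≈'_ π'[_]≈_ : Fin n → Fin n → Formula n
  𝒴'   : Fin n → Formula n
  ¬'_  : Formula n → Formula n
  _∧'_ : Formula n → Formula n → Formula n
  ∃'_  : Formula (suc n) → Formula n

module Models (S : Setting) where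
  open Setting S

  π[_] : Σ V (_∈ ω₂) → V
  π[ α ] = proj₁ (Bijection.to π α)

  -- Satisfaction in 𝒜 = (H(ω₂), ∈, π, 𝒴), for assignments with values in H(ω₂).
  𝒜⊨ : ∀ {n} → Formula n → Vector V n → Set₁
  𝒜⊨ (i ∈' j)     ρ = Lift (lsuc 0ℓ) (ρ i ∈ ρ j)
  𝒜⊨ (i ≈' j)     ρ = Lift (lsuc 0ℓ) (ρ i ≈ ρ j)
  𝒜⊨ (π'[ i ]≈ j) ρ = Lift (lsuc 0ℓ) (Σ (ρ i ∈ ω₂) λ p → π[ ρ i , p ] ≈ ρ j)
  𝒜⊨ (𝒴' i)       ρ = Lift (lsuc 0ℓ) (ρ i ∈ 𝒴)
  𝒜⊨ (¬' φ)       ρ = ¬ 𝒜⊨ φ ρ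
  𝒜⊨ (φ ∧' ψ)     ρ = 𝒜⊨ φ ρ × 𝒜⊨ ψ ρ
  𝒜⊨ (∃' φ)       ρ = ∃[ x ] H ω₂ x × 𝒜⊨ φ (x ∷ ρ)

  -- x is the value at ρ of the definable Skolem function for φ: the witness
  -- to ∃v φ(v, ρ) that is least in the well-ordering induced by π. The Skolem
  -- function is undefined where there is no witness.
  IsSkolemValue : ∀ {n} → Formula (suc n) → Vector V n → V → Set₁
  IsSkolemValue φ ρ x =
    ∃[ α ] IsLeast (λ β → Σ (β ∈ ω₂) λ p → 𝒜⊨ φ (π[ β , p ] ∷ ρ)) α
         × Σ (α ∈ ω₂) λ p → x ≈ π[ α , p ]

  data Sk (a : V) : V → Set₁ where
    base   : ∀ {x} → x ∈ a → Sk a x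
    skolem : ∀ {n} (φ : Formula (suc n)) (ρ : Vector V n) {x} →
             (∀ i → Sk a (ρ i)) → IsSkolemValue φ ρ x → Sk a x

  -- Sk(a) ∩ ω₂ = a
  SkClosed : V → Set₁
  SkClosed a = ∀ x → (Sk a x × x ∈ ω₂) ⇔ x ∈ a

  C : V → Set₁
  C β = β ∈ ω₂ × SkClosed β

  Λ : V → Set₁
  Λ β = β ∈ ω₂ × HasCofinality β ω₁ × LimitPoint C β

  𝒳 : V → Set₁
  𝒳 M = M ∈ 𝒴 × SkClosed M ×
        (∀ γ → γ ∈ M → ∃[ σ ] IsSup (λ δ → C δ × δ ∈ γ) σ × σ ∈ M)

  module Comparison (Γ : V) where

    -- β ∈ Γ_M, i.e. β = min(Γ ∖ sup(M ∩ β)).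
    InΓ : V → V → Set₁
    InΓ M β = ∃[ σ ] IsSup (_∈ M ∩ β) σ
                   × IsLeast (λ γ → γ ∈ Γ × ¬ γ ∈ σ) β

    -- β = β_{M,N}
    IsComparisonPoint : V → V → V → Set₁
    IsComparisonPoint M N = IsGreatest (λ β → InΓ M β × InΓ N β)

    Adequate : V → Set₁
    Adequate A =
      (∀ M → M ∈ A → 𝒳 M) ×
      (∀ M N → M ∈ A → N ∈ A →
        ∃[ β ] IsComparisonPoint M N β ×
          (M ∩ β ≈ N ∩ β ⊎ Sk N (M ∩ β) ⊎ Sk M (N ∩ β)))

    Closed : V → V → Set₁
    Closed N A =
      ∀ M β → M ∈ A → IsComparisonPoint M N β → Sk N (M ∩ β) → M ∩ β ∈ A

  open Comparison public

open Models public

{-# OPTIONS --safe #-}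
module Submission where

-- The essential case is K ∈ B, M ∈ A. Put β = β_{M,N}. Since K is a countable
-- element of Sk(N), K ⊆ N, so Γ_K ⊆ Γ_N and Γ_K ∩ Γ_M is bounded by β.
-- By thinness K ∩ β ∈ Sk(β), hence its π-code lies in N ∩ β and
-- K ∩ β ∈ Sk(N ∩ β). If M ∩ β = N ∩ β or N ∩ β ∈ Sk(M), then N ∩ β ⊆ M, and
-- Sk(M) contains K ∩ β and therefore K ∩ β_{K,M}. If M ∩ β ∈ Sk(N), then
-- M ∩ β ∈ A ∩ Sk(N) ⊆ B; moreover β_{K,M∩β} = β_{K,M} because
-- Γ_{M∩β} = Γ_M ∩ (β + 1), so the adequacy of B applies to K and M ∩ β.

open import Axiom.ExcludedMiddle using (ExcludedMiddle)
open import Data.Bool using (Bool; true; false; if_then_else_)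
open import Data.Empty using (⊥; ⊥-elim)
open import Data.Fin using (Fin) renaming (zero to fzero; suc to fsuc)
open import Data.Fin.Patterns using (0F; 1F; 2F; 3F)
open import Data.Nat as ℕ using (ℕ)
import Data.Nat.Properties as ℕ
open import Data.Product using (Σ; ∃-syntax; _×_; _,_; proj₁; proj₂)
open import Data.Sum using (_⊎_; inj₁; inj₂; [_,_]′)
open import Data.Unit using (⊤; tt)
open import Data.Vec.Functional using (Vector; []) renaming (_∷_ to infixr 5 _◂_)
open import Function using (_∘_; case_of_)
import Function.Construct.Composition as Compose
open import Function.Bundles using (Injection; Bijection; Equivalence; mk⇔)
open import Level using (0ℓ; suc; _⊔_; Lift; lift; lower)
open import Relation.Binary.Construct.Closure.Transitive using (TransClosure; [_]; _∷_; _++_)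
open import Relation.Binary.Definitions using (tri<; tri≈; tri>)
open import Relation.Binary.PropositionalEquality as ≡ using (_≡_; refl)
open import Relation.Nullary using (¬_; Dec; yes; no)
import Relation.Nullary.Decidable as Dec
open import Defs

-- Sets

-- Membership of β in Λ supplies what thinness alone does not. Cofinality ω₁ bounds the countable
-- set K ∩ β by some γ < β, and a limit point of C satisfies Sk(β) ∩ ω₂ = β. The family of all a ∈ 𝒴
-- with a ⊆ γ is definable from γ and has size at most ω₁. The least ordinal that enumerates it is
-- therefore below β, and every member of the family falls into Sk(β). The same device puts the
-- elements of a countable member of a hull into that hull: there the enumerating ordinal is at most
-- ω. Adequacy includes the existence of the comparison point. For K and M in different sets it is
-- not given, and the bound β is what makes a least upper bound argument in Γ possible. Since `Sk`
-- is generated by coded formulas, each appeal to definability becomes an explicit formula of 𝒜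
-- together with a proof that its witness is the intended set.

reflₛ : ∀ {x} → x ≈ x
reflₛ = ≈-refl _

symₛ : ∀ {x y} → x ≈ y → y ≈ x
symₛ = ≈-sym _ _

transₛ : ∀ {x y z} → x ≈ y → y ≈ z → x ≈ z
transₛ = ≈-trans _ _ _

∈-respˡ : ∀ {x y} z → x ≈ y → x ∈ z → y ∈ z
∈-respˡ z e (j , p) = j , transₛ (symₛ e) p

∈-respʳ : ∀ {x y z} → y ≈ z → x ∈ y → x ∈ z
∈-respʳ {x} {set I f} {set J g} (p , _) (i , r) = proj₁ (p i) , transₛ r (proj₂ (p i))

elem∈ : ∀ x i → elem x i ∈ x
elem∈ x i = i , reflₛ

≈-ext : ∀ x y → x ⊆ y → y ⊆ x → x ≈ y
≈-ext (set I f) (set J g) p q =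
  (λ i → p (f i) (i , reflₛ)) ,
  (λ j → let (i , e) = q (g j) (j , reflₛ) in i , symₛ e)

-- Structural recursion reaches only the chosen representatives `f i` of the members, so the inner
-- claim is made for every y ≈ x.
∈-ind : ∀ {ℓ} (P : V → Set ℓ) → (∀ x → (∀ y → y ∈ x → P y) → P x) → ∀ x → P x
∈-ind P step x = go x x reflₛ
  where
  go : ∀ x y → y ≈ x → P y
  go (set I f) y y≈x = step y λ z z∈y →
    let (i , z≈fi) = ∈-respʳ y≈x z∈y in go (f i) z z≈fi

∈-irrefl : ∀ x → ¬ x ∈ x
∈-irrefl = ∈-ind _ λ x ih x∈x → ih x x∈x x∈x

∈-asym : ∀ x y → x ∈ y → ¬ y ∈ x
∈-asym = ∈-ind _ λ x ih y x∈y y∈x → ih y y∈x x y∈x x∈y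

≈⇒∉ : ∀ {x y} → x ≈ y → ¬ x ∈ y
≈⇒∉ {x} {y} e p = ∈-irrefl y (∈-respˡ y e p)

∩⁺ : ∀ x y {z} → z ∈ x → z ∈ y → z ∈ x ∩ y
∩⁺ (set I f) y (i , e) z∈y = (i , ∈-respˡ y e z∈y) , e

∩⁻ˡ : ∀ x y {z} → z ∈ x ∩ y → z ∈ x
∩⁻ˡ (set I f) y ((i , _) , e) = i , e

∩⁻ʳ : ∀ x y {z} → z ∈ x ∩ y → z ∈ y
∩⁻ʳ (set I f) y ((i , p) , e) = ∈-respˡ y (symₛ e) p

∩-cong : ∀ x x′ y → x ≈ x′ → x ∩ y ≈ x′ ∩ y
∩-cong x x′ y e = ≈-ext _ _
  (λ z p → ∩⁺ x′ y (∈-respʳ e (∩⁻ˡ x y p)) (∩⁻ʳ x y p))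
  (λ z p → ∩⁺ x y (∈-respʳ (symₛ e) (∩⁻ˡ x′ y p)) (∩⁻ʳ x′ y p))

∪⁺ˡ : ∀ x y {z} → z ∈ x → z ∈ x ∪ y
∪⁺ˡ (set I f) (set J g) (i , e) = inj₁ i , e

∪⁺ʳ : ∀ x y {z} → z ∈ y → z ∈ x ∪ y
∪⁺ʳ (set I f) (set J g) (j , e) = inj₂ j , e

∪⁻ : ∀ x y {z} → z ∈ x ∪ y → z ∈ x ⊎ z ∈ y
∪⁻ (set I f) (set J g) (inj₁ i , e) = inj₁ (i , e)
∪⁻ (set I f) (set J g) (inj₂ j , e) = inj₂ (j , e)

pair : V → V → V
pair x y = set Bool λ b → if b then x else y

pair⁺ˡ : ∀ {x y z} → z ≈ x → z ∈ pair x y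
pair⁺ˡ e = true , e

pair⁺ʳ : ∀ {x y z} → z ≈ y → z ∈ pair x y
pair⁺ʳ e = false , e

pair⁻ : ∀ {x y z} → z ∈ pair x y → z ≈ x ⊎ z ≈ y
pair⁻ (true  , e) = inj₁ e
pair⁻ (false , e) = inj₂ e

pair-cong : ∀ {x x′ y y′} → x ≈ x′ → y ≈ y′ → pair x y ≈ pair x′ y′
pair-cong e e′ = (λ { true → true , e ; false → false , e′ }) ,
                 (λ { true → true , e ; false → false , e′ })

succ : V → V
succ x = x ∪ set ⊤ (λ _ → x)

succ⁺ : ∀ x {y} → y ∈ x → y ∈ succ x
succ⁺ x = ∪⁺ˡ x _

succ-∈ : ∀ x → x ∈ succ x
succ-∈ x = ∪⁺ʳ x _ (tt , reflₛ)

succ⁻ : ∀ x {y} → y ∈ succ x → y ≤ x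
succ⁻ x p with ∪⁻ x _ p
... | inj₁ q       = inj₁ q
... | inj₂ (_ , e) = inj₂ e

succ-cong : ∀ x y → x ≈ y → succ x ≈ succ y
succ-cong x y e = ≈-ext _ _ (half x y e) (half y x (symₛ e))
  where
  half : ∀ x y → x ≈ y → succ x ⊆ succ y
  half x y e z p with succ⁻ x p
  ... | inj₁ q = succ⁺ y (∈-respʳ e q)
  ... | inj₂ q = ∈-respˡ (succ y) (symₛ (transₛ q e)) (succ-∈ y)

-- Ordinals

Ord-∈ : ∀ α {β} → IsOrd α → β ∈ α → IsOrd β
Ord-∈ α {β} (tr , trs) β∈α = trs β β∈α , λ γ γ∈β → trs γ (tr β β∈α γ γ∈β)

Ord-trans : ∀ α β {γ} → IsOrd α → γ ∈ β → β ∈ α → γ ∈ α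
Ord-trans α β (tr , _) γ∈β β∈α = tr β β∈α _ γ∈β

Transitive-resp : ∀ {x y} → x ≈ y → Transitive x → Transitive y
Transitive-resp e tr z z∈y w w∈z = ∈-respʳ e (tr z (∈-respʳ (symₛ e) z∈y) w w∈z)

∈≤-trans : ∀ α β γ → IsOrd γ → α ∈ β → β ≤ γ → α ∈ γ
∈≤-trans α β γ oγ α∈β (inj₁ β∈γ) = Ord-trans γ β oγ α∈β β∈γ
∈≤-trans α β γ oγ α∈β (inj₂ β≈γ) = ∈-respʳ β≈γ α∈β

∈⇒≱ : ∀ α β → α ∈ β → ¬ β ≤ α
∈⇒≱ α β α∈β (inj₁ β∈α) = ∈-asym α β α∈β β∈α
∈⇒≱ α β α∈β (inj₂ β≈α) = ≈⇒∉ (symₛ β≈α) α∈β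

Transitive-succ : ∀ x → Transitive x → Transitive (succ x)
Transitive-succ x tr y y∈ z z∈y with succ⁻ x y∈
... | inj₁ y∈x = succ⁺ x (tr y y∈x z z∈y)
... | inj₂ y≈x = succ⁺ x (∈-respʳ y≈x z∈y)

Ord-succ : ∀ α → IsOrd α → IsOrd (succ α)
Ord-succ α oα = Transitive-succ α (proj₁ oα) , λ β β∈ → case succ⁻ α β∈ of λ where
  (inj₁ β∈α) → proj₁ (Ord-∈ α oα β∈α)
  (inj₂ β≈α) → Transitive-resp (symₛ β≈α) (proj₁ oα)

num : ℕ → V
num 0         = set ⊥ λ ()
num (ℕ.suc n) = succ (num n)

ω : V
ω = set ℕ num

num-Ord : ∀ n → IsOrd (num n)
num-Ord 0         = (λ { _ (() , _) }) , (λ { _ (() , _) })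
num-Ord (ℕ.suc n) = Ord-succ (num n) (num-Ord n)

num-∈ : ∀ {m n} → m ℕ.<′ n → num m ∈ num n
num-∈ {m} {ℕ.suc n} ℕ.<′-base    = succ-∈ (num n)
num-∈ {m} {ℕ.suc n} (ℕ.<′-step lt) = succ⁺ (num n) (num-∈ lt)

num-injective : ∀ m n → num m ≈ num n → m ≡ n
num-injective m n e with ℕ.<-cmp m n
... | tri< lt _ _ = ⊥-elim (≈⇒∉ e (num-∈ (ℕ.<⇒<′ lt)))
... | tri≈ _ eq _ = eq
... | tri> _ _ gt = ⊥-elim (≈⇒∉ (symₛ e) (num-∈ (ℕ.<⇒<′ gt)))

∈num⇒∈ω : ∀ n {x} → x ∈ num n → x ∈ ω
∈num⇒∈ω (ℕ.suc n) p with succ⁻ (num n) p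
... | inj₁ q = ∈num⇒∈ω n q
... | inj₂ e = n , e

ω-Ord : IsOrd ω
ω-Ord = (λ { y (n , e) z z∈y → ∈num⇒∈ω n (∈-respʳ e z∈y) }) ,
        (λ { y (n , e) → Transitive-resp (symₛ e) (proj₁ (num-Ord n)) })

-- dbl α = {dbl β, dbl β + 1 : β < α} is the ordinal 2·α. The maps dbl and
-- succ ∘ dbl embed two disjoint copies of α into dbl α.
dbl : V → V
dbl (set I f) = set (I ⊎ I) [ (λ i → dbl (f i)) , (λ i → succ (dbl (f i))) ]′

dbl-cong : ∀ x y → x ≈ y → dbl x ≈ dbl y
dbl-cong (set I f) (set J g) (p , q) =
  (λ where
    (inj₁ i) → inj₁ (proj₁ (p i)) , dbl-cong _ _ (proj₂ (p i))
    (inj₂ i) → inj₂ (proj₁ (p i)) , succ-cong _ _ (dbl-cong _ _ (proj₂ (p i)))) ,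
  (λ where
    (inj₁ j) → inj₁ (proj₁ (q j)) , dbl-cong _ _ (proj₂ (q j))
    (inj₂ j) → inj₂ (proj₁ (q j)) , succ-cong _ _ (dbl-cong _ _ (proj₂ (q j))))

dbl⁺ : ∀ x {y} → y ∈ x → dbl y ∈ dbl x
dbl⁺ (set I f) (i , e) = inj₁ i , dbl-cong _ _ e

succ-dbl⁺ : ∀ x {y} → y ∈ x → succ (dbl y) ∈ dbl x
succ-dbl⁺ (set I f) (i , e) = inj₂ i , succ-cong _ _ (dbl-cong _ _ e)

dbl⁻ : ∀ x {z} → z ∈ dbl x → ∃[ y ] y ∈ x × (z ≈ dbl y ⊎ z ≈ succ (dbl y))
dbl⁻ (set I f) (inj₁ i , e) = f i , (i , reflₛ) , inj₁ e
dbl⁻ (set I f) (inj₂ i , e) = f i , (i , reflₛ) , inj₂ e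

dbl-resp-∈ : ∀ x {y z} → y ∈ x → z ≈ dbl y ⊎ z ≈ succ (dbl y) → z ∈ dbl x
dbl-resp-∈ x y∈x (inj₁ e) = ∈-respˡ (dbl x) (symₛ e) (dbl⁺ x y∈x)
dbl-resp-∈ x y∈x (inj₂ e) = ∈-respˡ (dbl x) (symₛ e) (succ-dbl⁺ x y∈x)

Transitive-dbl : ∀ x → Transitive x → Transitive (dbl x)
Transitive-dbl x tr z z∈ w w∈z with dbl⁻ x z∈
... | y , y∈x , inj₁ e =
      let (v , v∈y , r) = dbl⁻ y (∈-respʳ e w∈z) in dbl-resp-∈ x (tr y y∈x v v∈y) r
... | y , y∈x , inj₂ e with succ⁻ (dbl y) (∈-respʳ e w∈z)
...   | inj₁ w∈ = let (v , v∈y , r) = dbl⁻ y w∈ in dbl-resp-∈ x (tr y y∈x v v∈y) r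
...   | inj₂ e′ = dbl-resp-∈ x y∈x (inj₁ e′)

Ord-dbl : ∀ α → IsOrd α → IsOrd (dbl α)
Ord-dbl α (tr , trs) = Transitive-dbl α tr , λ z z∈ → case dbl⁻ α z∈ of λ where
  (β , β∈α , inj₁ e) → Transitive-resp (symₛ e) (Transitive-dbl β (trs β β∈α))
  (β , β∈α , inj₂ e) → Transitive-resp (symₛ e)
    (Transitive-succ (dbl β) (Transitive-dbl β (trs β β∈α)))

dbl-succ : ∀ x → dbl (succ x) ≈ succ (succ (dbl x))
dbl-succ x = ≈-ext _ _ to from
  where
  to : dbl (succ x) ⊆ succ (succ (dbl x))
  to z z∈ with dbl⁻ (succ x) z∈
  ... | y , y∈ , r with succ⁻ x y∈ | r
  ... | inj₁ y∈x | _ = succ⁺ (succ (dbl x)) (succ⁺ (dbl x) (dbl-resp-∈ x y∈x r))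
  ... | inj₂ y≈x | inj₁ e = succ⁺ (succ (dbl x))
        (∈-respˡ (succ (dbl x)) (symₛ (transₛ e (dbl-cong _ _ y≈x))) (succ-∈ (dbl x)))
  ... | inj₂ y≈x | inj₂ e =
        ∈-respˡ (succ (succ (dbl x)))
                (symₛ (transₛ e (succ-cong _ _ (dbl-cong _ _ y≈x)))) (succ-∈ (succ (dbl x)))
  from : succ (succ (dbl x)) ⊆ dbl (succ x)
  from z z∈ with succ⁻ (succ (dbl x)) z∈
  ... | inj₂ e = dbl-resp-∈ (succ x) (succ-∈ x) (inj₂ e)
  ... | inj₁ z∈′ with succ⁻ (dbl x) z∈′
  ...   | inj₂ e = dbl-resp-∈ (succ x) (succ-∈ x) (inj₁ e)
  ...   | inj₁ z∈″ = let (y , y∈x , r) = dbl⁻ x z∈″ in dbl-resp-∈ (succ x) (succ⁺ x y∈x) r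

dbl-num : ∀ n → dbl (num n) ∈ ω
dbl-num 0         = 0 , ((λ { (inj₁ ()) ; (inj₂ ()) }) , λ ())
dbl-num (ℕ.suc n) =
  let (m , e) = dbl-num n
  in ℕ.suc (ℕ.suc m) , transₛ (dbl-succ (num n)) (succ-cong _ _ (succ-cong _ _ e))

-- Cardinality

-- R ≼ κ: the class R is the image of a subset of κ under a map, given by its
-- graph. Unlike an injection R → κ, this needs no choice of codes.
record _≼_ {ℓ} (R : V → Set ℓ) (κ : V) : Set (suc (suc 0ℓ) ⊔ ℓ) where
  field
    Codes  : V → V → Set₁
    total  : ∀ {x} → R x → ∃[ i ] i ∈ κ × Codes i x
    unique : ∀ {i j x y} → i ≈ j → Codes i x → Codes j y → x ≈ y

open _≼_

≼-mono : ∀ {ℓ ℓ′} {R : V → Set ℓ} {R′ : V → Set ℓ′} κ {κ′} →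
         (∀ x → R x → R′ x) → κ ⊆ κ′ → R′ ≼ κ → R ≼ κ′
≼-mono κ sub sub′ c = record
  { Codes  = Codes c
  ; total  = λ Rx → let (i , i∈κ , e) = total c (sub _ Rx) in i , sub′ i i∈κ , e
  ; unique = unique c
  }

≼-image : ∀ {ℓ ℓ′} {R : V → Set ℓ} {R′ : V → Set ℓ′} κ (Q : V → V → Set₁) →
          (∀ {y} → R′ y → ∃[ x ] R x × Q x y) →
          (∀ {x x′ y y′} → x ≈ x′ → Q x y → Q x′ y′ → y ≈ y′) →
          R ≼ κ → R′ ≼ κ
≼-image κ Q onto functional c = record
  { Codes  = λ i y → ∃[ x ] Codes c i x × Q x y
  ; total  = λ R′y → let (x , Rx , q) = onto R′y ; (i , i∈κ , e) = total c Rx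
                     in i , i∈κ , x , e , q
  ; unique = λ i≈j (x , e , q) (x′ , e′ , q′) → functional (unique c i≈j e e′) q q′
  }

≼-singleton : ∀ {ℓ} {R : V → Set ℓ} κ → ∃[ i ] i ∈ κ → (a : V) → (∀ x → R x → x ≈ a) → R ≼ κ
≼-singleton κ (i , i∈κ) a eq = record
  { Codes  = λ _ x → Lift _ (x ≈ a)
  ; total  = λ Rx → i , i∈κ , lift (eq _ Rx)
  ; unique = λ _ (lift e) (lift e′) → transₛ e (symₛ e′)
  }

∈-injection⇒≼ : ∀ x κ → Injection ⟦ _∈ x ⟧ ⟦ _∈ κ ⟧ → (_∈ x) ≼ κ
∈-injection⇒≼ x κ f = record
  { Codes  = λ i y → ∃[ z ] y ≈ z × Σ (z ∈ x) λ z∈x → proj₁ (to (z , z∈x)) ≈ i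
  ; total  = λ {y} y∈x → proj₁ (to (y , y∈x)) , proj₂ (to (y , y∈x)) , y , reflₛ , y∈x , reflₛ
  ; unique = λ i≈j (z , e , z∈x , c) (z′ , e′ , z′∈x , c′) →
      transₛ e (transₛ (injective {z , z∈x} {z′ , z′∈x} (transₛ c (transₛ i≈j (symₛ c′)))) (symₛ e′))
  }
  where open Injection f

injection⇒≼ : ∀ {R : V → Set₁} κ → Injection ⟦ R ⟧ ⟦ _∈ κ ⟧ → R ≼ κ
injection⇒≼ {R} κ f = record
  { Codes  = λ i y → Σ (R y) λ r → proj₁ (to (y , r)) ≈ i
  ; total  = λ {y} r → proj₁ (to (y , r)) , proj₂ (to (y , r)) , r , reflₛ
  ; unique = λ {i} {j} {y} {y′} i≈j (r , c) (r′ , c′) →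
      injective {y , r} {y′ , r′} (transₛ c (transₛ i≈j (symₛ c′)))
  }
  where open Injection f

countable⇒↪ω : ∀ x → Countable x → Injection ⟦ _∈ x ⟧ ⟦ _∈ ω ⟧
countable⇒↪ω x f = record
  { to        = λ p → num (to p) , to p , reflₛ
  ; cong      = λ {p} {q} e → ≡.subst (λ n → num (to p) ≈ num n) (cong {p} {q} e) reflₛ
  ; injective = λ {p} {q} e → injective {p} {q} (num-injective _ _ e)
  }
  where open Injection f

↪ω⇒countable : ∀ x → Injection ⟦ _∈ x ⟧ ⟦ _∈ ω ⟧ → Countable x
↪ω⇒countable x f = record
  { to        = index
  ; cong      = λ {p} {q} e → num-injective _ _
      (transₛ (symₛ (num-index p)) (transₛ (cong {p} {q} e) (num-index q)))
  ; injective = λ {p} {q} e → injective {p} {q}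
      (transₛ (num-index p)
        (transₛ (≡.subst (λ n → num (index p) ≈ num n) e reflₛ) (symₛ (num-index q))))
  }
  where
  open Injection f
  index : Σ V (_∈ x) → ℕ
  index p = proj₁ (proj₂ (to p))
  num-index : ∀ p → proj₁ (to p) ≈ num (index p)
  num-index p = proj₂ (proj₂ (to p))

inclusion : ∀ {ℓ ℓ′} {P : V → Set ℓ} {Q : V → Set ℓ′} → (∀ x → P x → Q x) → Injection ⟦ P ⟧ ⟦ Q ⟧
inclusion sub = record { to = λ (x , p) → x , sub x p ; cong = λ e → e ; injective = λ e → e }

trcl : V → V → Set₁
trcl x y = TransClosure _∈_ y x

trcl-∈ : ∀ {x y z} → y ∈ x → trcl y z → trcl x z
trcl-∈ y∈x t = t ++ [ y∈x ]

trcl-resp : ∀ {x y z} → x ≈ y → trcl x z → trcl y z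
trcl-resp e [ p ]   = [ ∈-respʳ e p ]
trcl-resp e (p ∷ t) = p ∷ trcl-resp e t

trcl-induction : ∀ {ℓ} (P : V → Set ℓ) {x} → (∀ y → y ∈ x → P y) →
                 (∀ y z → y ∈ z → P z → P y) → ∀ {y} → trcl x y → P y
trcl-induction P start step [ p ]   = start _ p
trcl-induction P start step (p ∷ t) = step _ _ p (trcl-induction P start step t)

-- Classical theory of ordinals and sizes

module Classical (em : ExcludedMiddle (suc 0ℓ)) where

  em₀ : (P : Set) → Dec P
  em₀ P = Dec.map′ lower lift (em {Lift (suc 0ℓ) P})

  ¬¬-elim : ∀ {P : Set₁} → ¬ ¬ P → P
  ¬¬-elim {P} ¬¬p with em {P}
  ... | yes p = p
  ... | no ¬p = ⊥-elim (¬¬p ¬p)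

  Ord-tri : ∀ α β → IsOrd α → IsOrd β → α ∈ β ⊎ α ≈ β ⊎ β ∈ α
  Ord-tri = ∈-ind _ λ α ihα → ∈-ind _ λ β ihβ oα oβ → step α β ihα ihβ oα oβ
    where
    step : ∀ α β →
      (∀ γ → γ ∈ α → ∀ β → IsOrd γ → IsOrd β → γ ∈ β ⊎ γ ≈ β ⊎ β ∈ γ) →
      (∀ γ → γ ∈ β → IsOrd α → IsOrd γ → α ∈ γ ⊎ α ≈ γ ⊎ γ ∈ α) →
      IsOrd α → IsOrd β → α ∈ β ⊎ α ≈ β ⊎ β ∈ α
    step α β ihα ihβ oα oβ with em₀ (α ∈ β) | em₀ (β ∈ α)
    ... | yes p | _     = inj₁ p
    ... | no _  | yes q = inj₂ (inj₂ q)
    ... | no ¬p | no ¬q = inj₂ (inj₁ (≈-ext α β ⊆₁ ⊆₂))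
      where
      ⊆₁ : α ⊆ β
      ⊆₁ γ γ∈α with ihα γ γ∈α β (Ord-∈ α oα γ∈α) oβ
      ... | inj₁ γ∈β        = γ∈β
      ... | inj₂ (inj₁ γ≈β) = ⊥-elim (¬q (∈-respˡ α γ≈β γ∈α))
      ... | inj₂ (inj₂ β∈γ) = ⊥-elim (¬q (Ord-trans α γ oα β∈γ γ∈α))
      ⊆₂ : β ⊆ α
      ⊆₂ γ γ∈β with ihβ γ γ∈β oα (Ord-∈ β oβ γ∈β)
      ... | inj₁ α∈γ        = ⊥-elim (¬p (Ord-trans β γ oβ α∈γ γ∈β))
      ... | inj₂ (inj₁ α≈γ) = ⊥-elim (¬p (∈-respˡ β (symₛ α≈γ) γ∈β))
      ... | inj₂ (inj₂ γ∈α) = γ∈α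

  ≤-or-∋ : ∀ α β → IsOrd α → IsOrd β → α ≤ β ⊎ β ∈ α
  ≤-or-∋ α β oα oβ with Ord-tri α β oα oβ
  ... | inj₁ p        = inj₁ (inj₁ p)
  ... | inj₂ (inj₁ e) = inj₁ (inj₂ e)
  ... | inj₂ (inj₂ q) = inj₂ q

  ∉⇒≤ : ∀ α β → IsOrd α → IsOrd β → ¬ β ∈ α → α ≤ β
  ∉⇒≤ α β oα oβ β∉α with ≤-or-∋ α β oα oβ
  ... | inj₁ p = p
  ... | inj₂ q = ⊥-elim (β∉α q)

  least : (P : V → Set₁) → (∀ α → P α → IsOrd α) → ∀ α → P α → ∃[ μ ] IsLeast P μ
  least P ord = ∈-ind _ λ α ih Pα → case em {∃[ β ] β ∈ α × P β} of λ where
    (yes (β , β∈α , Pβ)) → ih β β∈α Pβ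
    (no none) → α , Pα , λ β Pβ →
      ∉⇒≤ α β (ord α Pα) (ord β Pβ) λ β∈α → none (β , β∈α , Pβ)

  -- Each element goes to its least code. `IsCode` admits the codes of every y ≈ x, so the least one
  -- depends only on the class of x under `_≈_`, and no choice is made.
  ≼⇒injection : ∀ {ℓ} {R : V → Set ℓ} κ → IsOrd κ → R ≼ κ → Injection ⟦ R ⟧ ⟦ _∈ κ ⟧
  ≼⇒injection {R = R} κ oκ c = record
    { to        = λ p → code p , proj₁ (proj₁ (proj₂ (leastCode p)))
    ; cong      = λ {p} {q} e → Ord-≤-antisym (code-mono p q e) (code-mono q p (symₛ e))
    ; injective = λ {p} {q} e →
        let (x , p≈x , cx) = proj₂ (proj₁ (proj₂ (leastCode p)))
            (y , q≈y , cy) = proj₂ (proj₁ (proj₂ (leastCode q)))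
        in transₛ p≈x (transₛ (unique c e cx cy) (symₛ q≈y))
    }
    where
    IsCode : V → V → Set₁
    IsCode x i = i ∈ κ × ∃[ y ] x ≈ y × Codes c i y
    leastCode : (p : Σ V R) → ∃[ i ] IsLeast (IsCode (proj₁ p)) i
    leastCode (x , Rx) = let (i , i∈κ , e) = total c Rx in
      least (IsCode x) (λ α (α∈κ , _) → Ord-∈ κ oκ α∈κ) i (i∈κ , x , reflₛ , e)
    code : Σ V R → V
    code p = proj₁ (leastCode p)
    code-mono : ∀ p q → proj₁ p ≈ proj₁ q → code p ≤ code q
    code-mono p q e =
      let (i∈κ , y , q≈y , cy) = proj₁ (proj₂ (leastCode q))
      in proj₂ (proj₂ (leastCode p)) (code q) (i∈κ , y , transₛ e q≈y , cy)
    Ord-≤-antisym : ∀ {α β} → α ≤ β → β ≤ α → α ≈ β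
    Ord-≤-antisym {α} {β} (inj₁ p) q = ⊥-elim (∈⇒≱ α β p q)
    Ord-≤-antisym         (inj₂ e) _ = e

  dbl-injective : ∀ α β → IsOrd α → IsOrd β → dbl α ≈ dbl β → α ≈ β
  dbl-injective α β oα oβ e with Ord-tri α β oα oβ
  ... | inj₁ p         = ⊥-elim (≈⇒∉ e (dbl⁺ β p))
  ... | inj₂ (inj₁ e′) = e′
  ... | inj₂ (inj₂ q)  = ⊥-elim (≈⇒∉ (symₛ e) (dbl⁺ α q))

  succ-dbl-injective : ∀ α β → IsOrd α → IsOrd β → succ (dbl α) ≈ succ (dbl β) → α ≈ β
  succ-dbl-injective α β oα oβ e with Ord-tri α β oα oβ
  ... | inj₁ p         = ⊥-elim (∈⇒≱ _ _ (succ-dbl⁺ β p) (inj₁ (∈-respʳ (symₛ e) (succ-∈ (dbl β)))))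
  ... | inj₂ (inj₁ e′) = e′
  ... | inj₂ (inj₂ q)  = ⊥-elim (∈⇒≱ _ _ (succ-dbl⁺ α q) (inj₁ (∈-respʳ e (succ-∈ (dbl α)))))

  dbl≉succ-dbl : ∀ α β → IsOrd α → IsOrd β → ¬ dbl α ≈ succ (dbl β)
  dbl≉succ-dbl α β oα oβ e with Ord-tri α β oα oβ
  ... | inj₁ p         = ∈-asym _ _ (dbl⁺ β p) (∈-respʳ (symₛ e) (succ-∈ (dbl β)))
  ... | inj₂ (inj₁ e′) = ≈⇒∉ (dbl-cong β α (symₛ e′)) (∈-respʳ (symₛ e) (succ-∈ (dbl β)))
  ... | inj₂ (inj₂ q)  = ≈⇒∉ (symₛ e) (succ-dbl⁺ α q)

  -- Stands in for κ + κ = κ: such a κ has room for the codes of two classes at once. The instances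
  -- are ω and ω₁.
  DblClosed : V → Set₁
  DblClosed κ = ∀ α → α ∈ κ → dbl α ∈ κ × succ (dbl α) ∈ κ

  ≼-∪ : ∀ {ℓ ℓ₁ ℓ₂} {R : V → Set ℓ} {P : V → Set ℓ₁} {Q : V → Set ℓ₂} κ →
        IsOrd κ → DblClosed κ → (∀ x → R x → P x ⊎ Q x) → P ≼ κ → Q ≼ κ → R ≼ κ
  ≼-∪ {R = R} κ oκ closed cover p q = record
    { Codes  = Code
    ; total  = λ Rx → tot (cover _ Rx)
    ; unique = uniq
    }
    where
    Code : V → V → Set₁
    Code i x = ∃[ j ] j ∈ κ × (i ≈ dbl j × Codes p j x ⊎ i ≈ succ (dbl j) × Codes q j x)
    tot : ∀ {x} → _ → ∃[ i ] i ∈ κ × Code i x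
    tot (inj₁ Px) = let (j , j∈κ , c) = total p Px in
      dbl j , proj₁ (closed j j∈κ) , j , j∈κ , inj₁ (reflₛ , c)
    tot (inj₂ Qx) = let (j , j∈κ , c) = total q Qx in
      succ (dbl j) , proj₂ (closed j j∈κ) , j , j∈κ , inj₂ (reflₛ , c)
    uniq : ∀ {i i′ x y} → i ≈ i′ → Code i x → Code i′ y → x ≈ y
    uniq e (j , j∈ , r) (k , k∈ , s) with Ord-∈ κ oκ j∈ | Ord-∈ κ oκ k∈ | r | s
    ... | oj | ok | inj₁ (e₁ , c) | inj₁ (e₂ , d) =
          unique p (dbl-injective j k oj ok (transₛ (symₛ e₁) (transₛ e e₂))) c d
    ... | oj | ok | inj₁ (e₁ , c) | inj₂ (e₂ , d) =
          ⊥-elim (dbl≉succ-dbl j k oj ok (transₛ (symₛ e₁) (transₛ e e₂)))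
    ... | oj | ok | inj₂ (e₁ , c) | inj₁ (e₂ , d) =
          ⊥-elim (dbl≉succ-dbl k j ok oj (transₛ (symₛ e₂) (transₛ (symₛ e) e₁)))
    ... | oj | ok | inj₂ (e₁ , c) | inj₂ (e₂ , d) =
          unique q (succ-dbl-injective j k oj ok (transₛ (symₛ e₁) (transₛ e e₂))) c d

  ω-DblClosed : DblClosed ω
  ω-DblClosed α (n , e) =
    let (m , e′) = dbl-num n
        e″ = transₛ (dbl-cong α (num n) e) e′
    in (m , e″) , ℕ.suc m , succ-cong _ _ e″

  -- Sizes up to ω₁ and the sets in H(ω₂)

  module InSetting (S : Setting) where
    open Setting S

    ω₁-Ord : IsOrd ω₁
    ω₁-Ord = proj₁ (proj₁ isω₁)

    ω₂-Ord : IsOrd ω₂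
    ω₂-Ord = proj₁ (proj₁ isω₂)

    ∈ω₂⇒Ord : ∀ {α} → α ∈ ω₂ → IsOrd α
    ∈ω₂⇒Ord = Ord-∈ ω₂ ω₂-Ord

    ω₁-uncountable : ¬ (_∈ ω₁) ≼ ω
    ω₁-uncountable c = proj₂ (proj₁ isω₁) (↪ω⇒countable ω₁ (≼⇒injection ω ω-Ord c))

    ≼ω⇒∈ω₁ : ∀ α → IsOrd α → (_∈ α) ≼ ω → α ∈ ω₁
    ≼ω⇒∈ω₁ α oα c with ≤-or-∋ ω₁ α ω₁-Ord oα
    ... | inj₂ α∈ω₁ = α∈ω₁
    ... | inj₁ ω₁≤α = ⊥-elim (ω₁-uncountable
            (≼-mono ω (λ β β∈ω₁ → ∈≤-trans β ω₁ α oα β∈ω₁ ω₁≤α) (λ _ p → p) c))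

    ∈ω₁⇒≼ω : ∀ α → α ∈ ω₁ → (_∈ α) ≼ ω
    ∈ω₁⇒≼ω α α∈ω₁ with em {Countable α}
    ... | yes c = ∈-injection⇒≼ α ω (countable⇒↪ω α c)
    ... | no ¬c = ⊥-elim (∈⇒≱ α ω₁ α∈ω₁ (proj₂ isω₁ α (Ord-∈ ω₁ ω₁-Ord α∈ω₁ , ¬c)))

    ω∈ω₁ : ω ∈ ω₁
    ω∈ω₁ = ≼ω⇒∈ω₁ ω ω-Ord (∈-injection⇒≼ ω ω (inclusion λ _ p → p))

    ω₁-DblClosed : DblClosed ω₁
    ω₁-DblClosed α α∈ω₁ = ≼ω⇒∈ω₁ (dbl α) oδ dbl≼ω , ≼ω⇒∈ω₁ (succ (dbl α)) (Ord-succ (dbl α) oδ)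
      (≼-∪ ω ω-Ord ω-DblClosed (λ _ → succ⁻ (dbl α)) dbl≼ω
        (≼-singleton ω (num 0 , 0 , reflₛ) (dbl α) (λ _ e → e)))
      where
      oδ : IsOrd (dbl α)
      oδ = Ord-dbl α (Ord-∈ ω₁ ω₁-Ord α∈ω₁)
      Image : (V → V) → V → Set₁
      Image g z = ∃[ y ] y ∈ α × z ≈ g y
      image≼ω : (g : V → V) → (∀ x y → x ≈ y → g x ≈ g y) → Image g ≼ ω
      image≼ω g g-cong = ≼-image ω (λ y z → Lift _ (z ≈ g y))
        (λ (y , y∈α , e) → y , y∈α , lift e)
        (λ e (lift p) (lift q) → transₛ p (transₛ (g-cong _ _ e) (symₛ q)))
        (∈ω₁⇒≼ω α α∈ω₁)
      cover : ∀ z → z ∈ dbl α → Image dbl z ⊎ Image (λ y → succ (dbl y)) z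
      cover z z∈ with dbl⁻ α z∈
      ... | y , y∈α , inj₁ e = inj₁ (y , y∈α , e)
      ... | y , y∈α , inj₂ e = inj₂ (y , y∈α , e)
      dbl≼ω : (_∈ dbl α) ≼ ω
      dbl≼ω = ≼-∪ ω ω-Ord ω-DblClosed cover (image≼ω dbl dbl-cong)
        (image≼ω (λ y → succ (dbl y)) (λ x y e → succ-cong _ _ (dbl-cong x y e)))

    ≼ω₁-∪ : ∀ {ℓ ℓ₁ ℓ₂} {R : V → Set ℓ} {P : V → Set ℓ₁} {Q : V → Set ℓ₂} →
            (∀ x → R x → P x ⊎ Q x) → P ≼ ω₁ → Q ≼ ω₁ → R ≼ ω₁
    ≼ω₁-∪ = ≼-∪ ω₁ ω₁-Ord ω₁-DblClosed

    ≼ω₁⇒∈ω₂ : ∀ α → IsOrd α → (_∈ α) ≼ ω₁ → α ∈ ω₂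
    ≼ω₁⇒∈ω₂ α oα c with ≤-or-∋ ω₂ α ω₂-Ord oα
    ... | inj₂ α∈ω₂ = α∈ω₂
    ... | inj₁ ω₂≤α = ⊥-elim (proj₂ (proj₁ isω₂) (≼⇒injection ω₁ ω₁-Ord
            (≼-mono ω₁ (λ β β∈ω₂ → ∈≤-trans β ω₂ α oα β∈ω₂ ω₂≤α) (λ _ p → p) c)))

    ∈ω₂⇒≼ω₁ : ∀ α → α ∈ ω₂ → (_∈ α) ≼ ω₁
    ∈ω₂⇒≼ω₁ α α∈ω₂ with em {Injection ⟦ _∈ α ⟧ ⟦ _∈ ω₁ ⟧}
    ... | yes f = ∈-injection⇒≼ α ω₁ f
    ... | no ¬f = ⊥-elim (∈⇒≱ α ω₂ α∈ω₂ (proj₂ isω₂ α (∈ω₂⇒Ord α∈ω₂ , ¬f)))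

    ω₁∈ω₂ : ω₁ ∈ ω₂
    ω₁∈ω₂ = ≼ω₁⇒∈ω₂ ω₁ ω₁-Ord (∈-injection⇒≼ ω₁ ω₁ (inclusion λ _ p → p))

    ω∈ω₂ : ω ∈ ω₂
    ω∈ω₂ = Ord-trans ω₂ ω₁ ω₂-Ord ω∈ω₁ ω₁∈ω₂

    -- An ordinal below ω₂ has size at most ω₁. With the converse `≼ω₁⇒H`, closure properties of
    -- H(ω₂) reduce to covering a transitive closure by classes of size at most ω₁.
    H⇒≼ω₁ : ∀ {x} → H ω₂ x → trcl x ≼ ω₁
    H⇒≼ω₁ (α , α∈ω₂ , f) = ≼-image ω₁ (λ i y → Codes c i y) (λ r → total c r)
      (λ e p q → unique c e p q) (∈ω₂⇒≼ω₁ α α∈ω₂)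
      where c = injection⇒≼ α f

    ≼ω₁⇒H : ∀ {x} → trcl x ≼ ω₁ → H ω₂ x
    ≼ω₁⇒H c = ω₁ , ω₁∈ω₂ , ≼⇒injection ω₁ ω₁-Ord c

    H-resp : ∀ {x y} → x ≈ y → H ω₂ x → H ω₂ y
    H-resp e h = ≼ω₁⇒H (≼-mono ω₁ (λ _ → trcl-resp (symₛ e)) (λ _ p → p) (H⇒≼ω₁ h))

    H-∈ : ∀ {x y} → y ∈ x → H ω₂ x → H ω₂ y
    H-∈ y∈x h = ≼ω₁⇒H (≼-mono ω₁ (λ _ → trcl-∈ y∈x) (λ _ p → p) (H⇒≼ω₁ h))

    H-⊆ : ∀ {x y} → y ⊆ x → H ω₂ x → H ω₂ y
    H-⊆ {x} y⊆x h = ≼ω₁⇒H (≼-mono ω₁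
      (λ _ → trcl-induction (trcl x) (λ z z∈y → [ y⊆x z z∈y ]) (λ _ _ → _∷_)) (λ _ p → p) (H⇒≼ω₁ h))

    H-⊆∈ω₂ : ∀ x {γ} → γ ∈ ω₂ → x ⊆ γ → H ω₂ x
    H-⊆∈ω₂ x {γ} γ∈ω₂ x⊆γ = ≼ω₁⇒H (≼-mono ω₁
      (λ _ → trcl-induction (_∈ γ) x⊆γ (λ _ _ y∈z z∈γ → Ord-trans γ _ (∈ω₂⇒Ord γ∈ω₂) y∈z z∈γ))
      (λ _ p → p) (∈ω₂⇒≼ω₁ γ γ∈ω₂))

    H-∈ω₂ : ∀ {α} → α ∈ ω₂ → H ω₂ α
    H-∈ω₂ {α} α∈ω₂ = H-⊆∈ω₂ α α∈ω₂ (λ _ p → p)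

    -- Skolem hulls

    ⊨-resp : ∀ {n} (φ : Formula n) {ρ ρ′ : Vector V n} → (∀ i → ρ i ≈ ρ′ i) →
             𝒜⊨ S φ ρ → 𝒜⊨ S φ ρ′
    ⊨-resp (i ∈' j) {ρ′ = ρ′} e (lift p) = lift (∈-respˡ (ρ′ j) (e i) (∈-respʳ (e j) p))
    ⊨-resp (i ≈' j) e (lift p) = lift (transₛ (symₛ (e i)) (transₛ p (e j)))
    ⊨-resp (π'[ i ]≈ j) {ρ} {ρ′} e (lift (p , q)) = lift
      (p′ , transₛ (Bijection.cong π {ρ′ i , p′} {ρ i , p} (symₛ (e i))) (transₛ q (e j)))
      where p′ = ∈-respˡ ω₂ (e i) p
    ⊨-resp (𝒴' i) e (lift p) = lift (∈-respˡ 𝒴 (e i) p)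
    ⊨-resp (¬' φ) e ¬p p = ¬p (⊨-resp φ (λ i → symₛ (e i)) p)
    ⊨-resp (φ ∧' ψ) e (p , q) = ⊨-resp φ e p , ⊨-resp ψ e q
    ⊨-resp (∃' φ) e (x , Hx , p) = x , Hx ,
      ⊨-resp φ (λ { fzero → reflₛ ; (fsuc i) → e i }) p

    π-surjective : ∀ {x} → H ω₂ x → ∃[ α ] Σ (α ∈ ω₂) λ p → π[_] S (α , p) ≈ x
    π-surjective {x} Hx = let ((α , p) , e) = Bijection.surjective π (x , Hx)
                          in α , p , e {α , p} reflₛ

    -- The π-least witness depends on φ and ρ alone, so one x serves every b whose hull contains the
    -- parameters. To place a set in a hull it then suffices to find a formula that this set alone
    -- satisfies.
    skolem-witness : ∀ {n} (φ : Formula (ℕ.suc n)) (ρ : Vector V n) →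
      ∃[ x ] H ω₂ x × 𝒜⊨ S φ (x ◂ ρ) →
      ∃[ x ] H ω₂ x × 𝒜⊨ S φ (x ◂ ρ) × (∀ b → (∀ i → Sk S b (ρ i)) → Sk S b x)
    skolem-witness φ ρ (x , Hx , φx) =
      let (α , p , e) = π-surjective Hx
          (β , lst) = least (λ β → Σ (β ∈ ω₂) λ q → 𝒜⊨ S φ (π[_] S (β , q) ◂ ρ)) (λ _ → ∈ω₂⇒Ord ∘ proj₁)
            α (p , ⊨-resp φ (λ { fzero → symₛ e ; (fsuc i) → reflₛ }) φx)
          (q , φβ) = proj₁ lst
      in π[_] S (β , q) , proj₂ (Bijection.to π (β , q)) , φβ ,
         λ b Skρ → skolem φ ρ Skρ (β , lst , q , reflₛ)

    Sk-resp : ∀ {b x y} → x ≈ y → Sk S b x → Sk S b y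
    Sk-resp {b} e (base p) = base (∈-respˡ b e p)
    Sk-resp e (skolem φ ρ Skρ (α , lst , q , e′)) =
      skolem φ ρ Skρ (α , lst , q , transₛ (symₛ e) e′)

    Sk-mono : ∀ {b c x} → b ⊆ c → Sk S b x → Sk S c x
    Sk-mono b⊆c (base p) = base (b⊆c _ p)
    Sk-mono b⊆c (skolem φ ρ Skρ v) = skolem φ ρ (λ i → Sk-mono b⊆c (Skρ i)) v

    Sk⇒H : ∀ {b x} → b ⊆ ω₂ → Sk S b x → H ω₂ x
    Sk⇒H b⊆ω₂ (base p) = H-∈ω₂ (b⊆ω₂ _ p)
    Sk⇒H b⊆ω₂ (skolem φ ρ Skρ (α , _ , q , e)) =
      H-resp (symₛ e) (proj₂ (Bijection.to π (α , q)))

    SkClosed-∈ : ∀ {b x} → SkClosed S b → Sk S b x → x ∈ ω₂ → x ∈ b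
    SkClosed-∈ {x = x} cl s x∈ω₂ = Equivalence.to (cl x) (s , x∈ω₂)

    SkClosed-⊆ω₂ : ∀ {b} → SkClosed S b → b ⊆ ω₂
    SkClosed-⊆ω₂ cl x x∈b = proj₂ (Equivalence.from (cl x) x∈b)

    -- Definable elements of hulls

    ∀'[_]_ : ∀ {n} → Formula (ℕ.suc n) → Formula (ℕ.suc n) → Formula n
    ∀'[ φ ] ψ = ¬' (∃' (φ ∧' (¬' ψ)))

    ∀-elim : {P Q : V → Set₁} → ¬ (∃[ x ] H ω₂ x × P x × ¬ Q x) → ∀ x → H ω₂ x → P x → Q x
    ∀-elim h x Hx Px = ¬¬-elim λ ¬Qx → h (x , Hx , Px , ¬Qx)

    ∀-intro : {P Q : V → Set₁} → (∀ x → H ω₂ x → P x → Q x) → ¬ (∃[ x ] H ω₂ x × P x × ¬ Q x)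
    ∀-intro h (x , Hx , Px , ¬Qx) = ¬Qx (h x Hx Px)

    -- Variable 1 of φ stands for the set being defined and is not constrained:
    -- it only spares a weakening operation on formulas.
    Sk-comprehension : ∀ {n} (φ : Formula (ℕ.suc (ℕ.suc n))) (ρ : Vector V n) y → H ω₂ y →
      (∀ x z → H ω₂ z → z ∈ y → 𝒜⊨ S φ (z ◂ x ◂ ρ)) →
      (∀ x z → H ω₂ z → 𝒜⊨ S φ (z ◂ x ◂ ρ) → z ∈ y) →
      ∀ {b} → (∀ i → Sk S b (ρ i)) → Sk S b y
    Sk-comprehension φ ρ y Hy to from Skρ =
      let (x , Hx , (x⊆ , ⊆x) , Skx) = skolem-witness
            ((∀'[ 0F ∈' 1F ] φ) ∧' (∀'[ φ ] (0F ∈' 1F))) ρ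
            (y , Hy , ∀-intro (λ z Hz z∈y → to y z Hz (lower z∈y)) ,
                      ∀-intro (λ z Hz φz → lift (from y z Hz φz)))
      in Sk-resp (≈-ext x y
           (λ z z∈x → let Hz = H-∈ z∈x Hx in from x z Hz (∀-elim x⊆ z Hz (lift z∈x)))
           (λ z z∈y → let Hz = H-∈ z∈y Hy in lower (∀-elim ⊆x z Hz (to x z Hz z∈y))))
         (Skx _ Skρ)

    Sk-num : ∀ {b} n → Sk S b (num n)
    Sk-num 0 = Sk-comprehension (¬' (0F ≈' 0F)) [] (num 0)
      (H-∈ω₂ (Ord-trans ω₂ ω ω₂-Ord (0 , reflₛ) ω∈ω₂))
      (λ { _ _ _ (() , _) }) (λ _ _ _ p → ⊥-elim (p (lift reflₛ))) (λ ())
    -- By De Morgan the formula says z ∈ n or z = n. The parameter n is variable 2, behind the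
    -- member z and the unconstrained variable for the set.
    Sk-num (ℕ.suc n) = Sk-comprehension (¬' ((¬' (0F ∈' 2F)) ∧' (¬' (0F ≈' 2F)))) (num n ◂ []) (num (ℕ.suc n))
      (H-∈ω₂ (Ord-trans ω₂ ω ω₂-Ord (ℕ.suc n , reflₛ) ω∈ω₂))
      (λ _ z _ z∈ (z∉ , z≉) → [ (λ p → z∉ (lift p)) , (λ p → z≉ (lift p)) ]′ (succ⁻ (num n) z∈))
      (λ _ z _ p → [ succ⁺ (num n) , (λ e → ∈-respˡ (num (ℕ.suc n)) (symₛ e) (succ-∈ (num n))) ]′ (z≤ z p))
      (λ { 0F → Sk-num n })
      where
      z≤ : ∀ z → ¬ (¬ Lift (suc 0ℓ) (z ∈ num n) × ¬ Lift (suc 0ℓ) (z ≈ num n)) → z ≤ num n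
      z≤ z p with em₀ (z ∈ num n) | em₀ (z ≈ num n)
      ... | yes q | _     = inj₁ q
      ... | no _  | yes q = inj₂ q
      ... | no ¬q | no ¬r = ⊥-elim (p ((λ q → ¬q (lower q)) , (λ r → ¬r (lower r))))

    -- F codes a partial map i ↦ d by the sets {i, {i, d}}, which determine i and
    -- d by foundation. The case d ≈ i is excluded.
    Maps : V → V → V → Set₁
    Maps F i d = ∃[ g ] ∃[ v ] g ∈ F × v ∈ g × i ∈ g × i ∈ v × d ∈ v × ¬ d ≈ i

    -- In essence a map from part of μ onto T. A member equal to its own index needs no code, since
    -- a hull containing the index contains it already. Uniqueness ranges over H(ω₂) because the
    -- quantifiers of 𝒜 do.
    Enumerates : V → V → V → Set₁
    Enumerates F T μ = ∀ d → d ∈ T → ∃[ i ] i ∈ μ ×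
      (¬ d ≈ i → Maps F i d × (∀ d′ → H ω₂ d′ → Maps F i d′ → d′ ≈ d))

    -- Of the four ways to place i and v in {j, {j, e}}, two give i ∈ i and one gives i ∈ j ∈ i.
    -- Foundation leaves only i = j and v = {j, e}.
    code-inversion : ∀ {i j d e v} → v ∈ pair j (pair j e) → i ∈ pair j (pair j e) →
                     i ∈ v → d ∈ v → ¬ d ≈ i → i ≈ j × d ≈ e
    code-inversion {i} {j} {d} {e} {v} v∈ i∈ i∈v d∈v d≉i with pair⁻ v∈ | pair⁻ i∈
    ... | inj₁ v≈j | inj₁ i≈j = ⊥-elim (≈⇒∉ (transₛ i≈j (symₛ v≈j)) i∈v)
    ... | inj₁ v≈j | inj₂ i≈p = ⊥-elim (∈-asym i j (∈-respʳ v≈j i∈v)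
                                         (∈-respʳ (symₛ i≈p) (pair⁺ˡ {j} {e} reflₛ)))
    ... | inj₂ v≈p | inj₂ i≈p = ⊥-elim (≈⇒∉ (transₛ i≈p (symₛ v≈p)) i∈v)
    ... | inj₂ v≈p | inj₁ i≈j with pair⁻ {j} {e} (∈-respʳ v≈p d∈v)
    ...   | inj₁ d≈j = ⊥-elim (d≉i (transₛ d≈j (symₛ i≈j)))
    ...   | inj₂ d≈e = i≈j , d≈e

    module Coding (T μ : V) (HT : H ω₂ T) (μ∈ω₂ : μ ∈ ω₂)
                  (f : Injection ⟦ _∈ T ⟧ ⟦ _∈ μ ⟧) where
      open Injection f

      index : ∀ d → d ∈ T → V
      index d d∈T = proj₁ (to (d , d∈T))

      index-cong : ∀ {d d′} (p : d ∈ T) (p′ : d′ ∈ T) → d ≈ d′ → index d p ≈ index d′ p′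
      index-cong {d} {d′} p p′ e = cong {d , p} {d′ , p′} e

      code : ∀ d → d ∈ T → V
      code d p = pair (index d p) (pair (index d p) d)

      graph : V
      graph = set (Index T) λ j → code (elem T j) (elem∈ T j)

      code-cong : ∀ {d d′} (p : d ∈ T) (p′ : d′ ∈ T) → d ≈ d′ → code d p ≈ code d′ p′
      code-cong p p′ e = pair-cong (index-cong p p′ e) (pair-cong (index-cong p p′ e) e)

      T≼ω₁ : (_∈ T) ≼ ω₁
      T≼ω₁ = ≼-mono ω₁ (λ _ → [_]) (λ _ p → p) (H⇒≼ω₁ HT)

      -- The transitive closure is covered by four classes of size at most ω₁: the codes, their
      -- inner pairs, the transitive closure of T, and μ. Their union `P` is closed under taking
      -- members.
      graph-∈H : H ω₂ graph
      graph-∈H = ≼ω₁⇒H (≼ω₁-∪ (λ _ t → trcl-induction P start step t)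
        (≼ω₁-∪ (λ _ r → r) (image (λ d p → code d p) code-cong)
                           (image (λ d p → pair (index d p) d)
                                  (λ p p′ e → pair-cong (index-cong p p′ e) e)))
        (≼ω₁-∪ (λ _ r → r) (H⇒≼ω₁ HT) (∈ω₂⇒≼ω₁ μ μ∈ω₂)))
        where
        Image : ((d : V) → d ∈ T → V) → V → Set₁
        Image g y = ∃[ d ] Σ (d ∈ T) λ p → y ≈ g d p
        image : (g : (d : V) → d ∈ T → V) →
                (∀ {d d′} (p : d ∈ T) (p′ : d′ ∈ T) → d ≈ d′ → g d p ≈ g d′ p′) →
                Image g ≼ ω₁
        image g g-cong = ≼-image ω₁ (λ d y → Σ (d ∈ T) λ p → Lift (suc 0ℓ) (y ≈ g d p))
          (λ (d , p , e) → d , p , p , lift e)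
          (λ e (p , lift q) (p′ , lift q′) → transₛ q (transₛ (g-cong p p′ e) (symₛ q′)))
          T≼ω₁
        P : V → Set₁
        P y = (Image code y ⊎ Image (λ d p → pair (index d p) d) y) ⊎ (trcl T y ⊎ y ∈ μ)
        start : ∀ y → y ∈ graph → P y
        start y (j , e) = inj₁ (inj₁ (elem T j , elem∈ T j , e))
        index∈ : ∀ {y d} (p : d ∈ T) → y ≈ index d p → P y
        index∈ p e = inj₂ (inj₂ (∈-respˡ μ (symₛ e) (proj₂ (to (_ , p)))))
        step : ∀ y z → y ∈ z → P z → P y
        step y z y∈z (inj₁ (inj₁ (d , p , e))) with pair⁻ {index d p} (∈-respʳ e y∈z)
        ... | inj₁ e′ = index∈ p e′
        ... | inj₂ e′ = inj₁ (inj₂ (d , p , e′))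
        step y z y∈z (inj₁ (inj₂ (d , p , e))) with pair⁻ {index d p} {d} (∈-respʳ e y∈z)
        ... | inj₁ e′ = index∈ p e′
        ... | inj₂ e′ = inj₂ (inj₁ [ ∈-respˡ T (symₛ e′) p ])
        step y z y∈z (inj₂ (inj₁ t))   = inj₂ (inj₁ (y∈z ∷ t))
        step y z y∈z (inj₂ (inj₂ z∈μ)) = inj₂ (inj₂ (Ord-trans μ z (∈ω₂⇒Ord μ∈ω₂) y∈z z∈μ))

      graph-enumerates : Enumerates graph T μ
      -- The code found in `graph` is that of the representative `elem T k`, which equals d only up
      -- to `_≈_`.
      graph-enumerates d d∈T@(k , d≈k) = i , proj₂ (to (d , d∈T)) , λ d≉i →
        ( code (elem T k) k∈ , pair (index (elem T k) k∈) (elem T k)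
        , (k , reflₛ) , pair⁺ʳ reflₛ , pair⁺ˡ i≈ , pair⁺ˡ i≈ , pair⁺ʳ d≈k , d≉i) ,
        λ { d′ _ (g , v , (j , g≈) , v∈g , i∈g , i∈v , d′∈v , d′≉i) →
          let (i≈j , d′≈) = code-inversion (∈-respʳ g≈ v∈g) (∈-respʳ g≈ i∈g) i∈v d′∈v d′≉i
          in transₛ d′≈ (symₛ (injective {d , d∈T} {elem T j , elem∈ T j} i≈j)) }
        where
        i : V
        i = index d d∈T
        k∈ : elem T k ∈ T
        k∈ = elem∈ T k
        i≈ : i ≈ index (elem T k) k∈
        i≈ = index-cong d∈T k∈ d≈k

    mapsF : ∀ {n} → Fin n → Fin n → Fin n → Formula n
    mapsF f i d = ∃' (∃' ((1F ∈' fsuc (fsuc f)) ∧' ((0F ∈' 1F) ∧' ((fsuc (fsuc i) ∈' 1F) ∧'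
      ((fsuc (fsuc i) ∈' 0F) ∧' ((fsuc (fsuc d) ∈' 0F) ∧' (¬' (fsuc (fsuc d) ≈' fsuc (fsuc i)))))))))

    mapsF⁺ : ∀ {n} f i d (ρ : Vector V n) → H ω₂ (ρ f) → Maps (ρ f) (ρ i) (ρ d) → 𝒜⊨ S (mapsF f i d) ρ
    mapsF⁺ f i d ρ HF (g , v , g∈ , v∈ , i∈g , i∈v , d∈v , d≉i) =
      g , H-∈ g∈ HF , v , H-∈ v∈ (H-∈ g∈ HF) ,
      lift g∈ , lift v∈ , lift i∈g , lift i∈v , lift d∈v , d≉i ∘ lower

    mapsF⁻ : ∀ {n} f i d (ρ : Vector V n) → 𝒜⊨ S (mapsF f i d) ρ → Maps (ρ f) (ρ i) (ρ d)
    mapsF⁻ f i d ρ (g , _ , v , _ , lift g∈ , lift v∈ , lift i∈g , lift i∈v , lift d∈v , d≉i) =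
      g , v , g∈ , v∈ , i∈g , i∈v , d∈v , d≉i ∘ lift

    -- Expresses `Enumerates`; the implication from `¬ d ≈ i` is written as the negation of a
    -- conjunction.
    enumF : ∀ {n} → Fin n → Fin n → Fin n → Formula n
    enumF f t m = ∀'[ 0F ∈' fsuc t ] (∃' ((0F ∈' fsuc (fsuc m)) ∧'
      (¬' ((¬' (1F ≈' 0F)) ∧' (¬' (mapsF (fsuc (fsuc f)) 0F 1F ∧'
        (∀'[ mapsF (fsuc (fsuc (fsuc f))) 1F 0F ] (0F ≈' 2F))))))))

    enumF⁺ : ∀ {n} f t m (ρ : Vector V n) → H ω₂ (ρ f) → H ω₂ (ρ m) →
             Enumerates (ρ f) (ρ t) (ρ m) → 𝒜⊨ S (enumF f t m) ρ
    enumF⁺ f t m ρ HF Hm en = ∀-intro λ d Hd d∈T →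
      let (i , i∈m , h) = en d (lower d∈T) in
      i , H-∈ i∈m Hm , lift i∈m , λ (d≉i , ¬maps) → ¬maps (
        mapsF⁺ (fsuc (fsuc f)) 0F 1F (i ◂ d ◂ ρ) HF (proj₁ (h (d≉i ∘ lift))) ,
        ∀-intro λ d′ Hd′ p → lift (proj₂ (h (d≉i ∘ lift)) d′ Hd′
          (mapsF⁻ (fsuc (fsuc (fsuc f))) 1F 0F (d′ ◂ i ◂ d ◂ ρ) p)))

    enumF⁻ : ∀ {n} f t m (ρ : Vector V n) → H ω₂ (ρ f) → H ω₂ (ρ t) →
             𝒜⊨ S (enumF f t m) ρ → Enumerates (ρ f) (ρ t) (ρ m)
    enumF⁻ f t m ρ HF HT en d d∈T =
      let (i , _ , lift i∈m , h) = ∀-elim en d (H-∈ d∈T HT) (lift d∈T) in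
      i , i∈m , λ d≉i →
        let (p , q) = ¬¬-elim (λ ¬r → h (d≉i ∘ lower , ¬r)) in
        mapsF⁻ (fsuc (fsuc f)) 0F 1F (i ◂ d ◂ ρ) p ,
        λ d′ Hd′ r → lower (∀-elim q d′ Hd′ (mapsF⁺ (fsuc (fsuc (fsuc f))) 1F 0F (d′ ◂ i ◂ d ◂ ρ) HF r))

    Enumerable : V → V → Set₁
    Enumerable T μ = ∃[ F ] H ω₂ F × Enumerates F T μ

    -- ν is the least ordinal that enumerates T: this is definable from T, so μ
    -- itself need not be in Sk(b).
    Sk-enumeration : ∀ {b T} μ → SkClosed S b → Sk S b T → H ω₂ T →
      μ ∈ ω₂ → Injection ⟦ _∈ T ⟧ ⟦ _∈ μ ⟧ →
      ∃[ ν ] ν ∈ b × ν ≤ μ × ((∀ i → i ∈ ν → Sk S b i) → ∀ d → d ∈ T → Sk S b d)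
    Sk-enumeration {b} {T} μ cl SkT HT μ∈ω₂ f =
      let (κ , (κ∈ω₂ , F , HF , en) , κ-least) =
            least (λ κ → κ ∈ ω₂ × Enumerable T κ) (λ _ → ∈ω₂⇒Ord ∘ proj₁)
              μ (μ∈ω₂ , graph , graph-∈H , graph-enumerates)
          (_ , π-code) = Bijection.to π (κ , κ∈ω₂)
          (ν , Hν , ((_ , _ , lift (ν∈ω₂ , _)) , (F₀ , HF₀ , en₀) , ν-min) , Sk-ν) =
            skolem-witness
              -- The three conjuncts: ν is in the domain of π, hence an ordinal below ω₂; some F
              -- enumerates T by ν; no element of ν does so. The ordinal κ only shows that the
              -- formula is satisfiable.
              ((∃' (π'[ 1F ]≈ 0F)) ∧' ((∃' (enumF 0F 2F 1F)) ∧'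
                (¬' (∃' ((0F ∈' 1F) ∧' (∃' (enumF 0F 3F 1F)))))))
              (T ◂ [])
              (κ , H-∈ω₂ κ∈ω₂
              , (π[_] S (κ , κ∈ω₂) , π-code , lift (κ∈ω₂ , reflₛ))
              , (F , HF , enumF⁺ 0F 2F 1F (F ◂ κ ◂ T ◂ []) HF (H-∈ω₂ κ∈ω₂) en)
              , λ (κ′ , _ , lift κ′∈κ , F′ , HF′ , en′) → ∈⇒≱ κ′ κ κ′∈κ
                  (κ-least κ′ (Ord-trans ω₂ κ ω₂-Ord κ′∈κ κ∈ω₂ , F′ , HF′ ,
                    enumF⁻ 0F 3F 1F (F′ ◂ κ′ ◂ κ ◂ T ◂ []) HF′ HT en′)))
          Skν = Sk-ν b λ { 0F → SkT }
          -- Many sets enumerate T by ν. A second Skolem function, with parameters ν and T, selects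
          -- one that lies in the hull.
          (F₁ , HF₁ , en₁ , Sk-F₁) = skolem-witness (enumF 0F 2F 1F) (ν ◂ T ◂ []) (F₀ , HF₀ , en₀)
          SkF₁ = Sk-F₁ b λ { 0F → Skν ; 1F → SkT }
          enum = enumF⁻ 0F 2F 1F (F₁ ◂ ν ◂ T ◂ []) HF₁ HT en₁
      in ν , SkClosed-∈ cl Skν ν∈ω₂
         , ∉⇒≤ ν μ (∈ω₂⇒Ord ν∈ω₂) (∈ω₂⇒Ord μ∈ω₂) (λ μ∈ν → ν-min
             (μ , H-∈ω₂ μ∈ω₂ , lift μ∈ν , graph , graph-∈H ,
              enumF⁺ 0F 3F 1F (graph ◂ μ ◂ ν ◂ T ◂ []) graph-∈H (H-∈ω₂ μ∈ω₂) graph-enumerates))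
         , λ ν⊆ d d∈T → let (i , i∈ν , h) = enum d d∈T in
             value F₁ HF₁ SkF₁ (ν⊆ i i∈ν) d (H-∈ d∈T HT) h
      where
      open Coding T μ HT μ∈ω₂ f
      value : ∀ F → H ω₂ F → Sk S b F → ∀ {i} → Sk S b i → ∀ d → H ω₂ d →
              (¬ d ≈ i → Maps F i d × (∀ d′ → H ω₂ d′ → Maps F i d′ → d′ ≈ d)) → Sk S b d
      value F HF SkF {i} Ski d Hd h with em₀ (d ≈ i)
      ... | yes e = Sk-resp (symₛ e) Ski
      ... | no d≉i =
        let (d′ , Hd′ , p , Skd′) = skolem-witness (mapsF 1F 2F 0F) (F ◂ i ◂ [])
              (d , Hd , mapsF⁺ 1F 2F 0F (d ◂ F ◂ i ◂ []) HF (proj₁ (h d≉i)))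
        in Sk-resp (proj₂ (h d≉i) d′ Hd′ (mapsF⁻ 1F 2F 0F (d′ ◂ F ◂ i ◂ []) p))
             (Skd′ b λ { 0F → SkF ; 1F → Ski })

    -- The enumerating ordinal is at most ω, so its elements are natural numbers, and these lie in
    -- every hull.
    Sk-countable-⊆ : ∀ {b x} → SkClosed S b → Sk S b x → H ω₂ x → Countable x →
                     ∀ d → d ∈ x → Sk S b d
    Sk-countable-⊆ {b} {x} cl Skx Hx ctbl =
      let (ν , _ , ν≤ω , sub) = Sk-enumeration ω cl Skx Hx ω∈ω₂ (countable⇒↪ω x ctbl)
      in sub λ i i∈ν → let (n , e) = ∈≤-trans i ν ω ω-Ord i∈ν ν≤ω in Sk-resp (symₛ e) (Sk-num n)

    -- The ordinal β itself may be missing from the hull. The least ξ in x outside β is in b and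
    -- satisfies x ∩ ξ = x ∩ β; if there is no such ξ, then x ∩ β = x.
    Sk-∩ : ∀ {b} x β → Sk S b x → H ω₂ x → x ⊆ ω₂ → x ⊆ b → IsOrd β → Sk S b (x ∩ β)
    Sk-∩ {b} x β Skx Hx x⊆ω₂ x⊆b oβ with em {∃[ ξ ] ξ ∈ x × ¬ ξ ∈ β}
    ... | no none = Sk-resp (≈-ext x (x ∩ β)
            (λ z z∈x → ∩⁺ x β z∈x (Dec.decidable-stable (em₀ (z ∈ β)) λ z∉β → none (z , z∈x , z∉β)))
            (λ z → ∩⁻ˡ x β)) Skx
    ... | yes (ξ₀ , ξ₀∈x , ξ₀∉β) =
      let (ξ , lift (ξ∈x , ξ∉β) , ξ-least) = least (λ ξ → Lift (suc 0ℓ) (ξ ∈ x × ¬ ξ ∈ β))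
            (λ _ → ∈ω₂⇒Ord ∘ x⊆ω₂ _ ∘ proj₁ ∘ lower) ξ₀ (lift (ξ₀∈x , ξ₀∉β))
          oξ = ∈ω₂⇒Ord (x⊆ω₂ ξ ξ∈x)
      in Sk-resp (≈-ext (x ∩ ξ) (x ∩ β)
            (λ z z∈ → let z∈x = ∩⁻ˡ x ξ z∈ in ∩⁺ x β z∈x
              (Dec.decidable-stable (em₀ (z ∈ β)) λ z∉β →
                ∈⇒≱ z ξ (∩⁻ʳ x ξ z∈) (ξ-least z (lift (z∈x , z∉β)))))
            (λ z z∈ → ∩⁺ x ξ (∩⁻ˡ x β z∈)
              (∈≤-trans z β ξ oξ (∩⁻ʳ x β z∈) (∉⇒≤ β ξ oβ oξ ξ∉β))))
         (Sk-comprehension ((0F ∈' 2F) ∧' (0F ∈' 3F)) (x ◂ ξ ◂ []) (x ∩ ξ)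
            (H-⊆ (λ z → ∩⁻ˡ x ξ) Hx)
            (λ _ z _ z∈ → lift (∩⁻ˡ x ξ z∈) , lift (∩⁻ʳ x ξ z∈))
            (λ _ z _ (p , q) → ∩⁺ x ξ (lower p) (lower q))
            (λ { 0F → Skx ; 1F → base (x⊆b ξ ξ∈x) }))

    -- Limit points of C, thinness and initial segments

    C-bound : ∀ β → IsOrd β → LimitPoint (C S) β → ∀ n (g : Fin n → V) → (∀ i → g i ∈ β) →
              ∃[ γ ] C S γ × γ ∈ β × (∀ i → g i ∈ γ)
    C-bound β oβ ((α , α∈β) , lim) ℕ.zero g g∈β =
      let (γ , Cγ , _ , γ∈β) = lim α α∈β in γ , Cγ , γ∈β , λ ()
    C-bound β oβ L@(_ , lim) (ℕ.suc n) g g∈β with C-bound β oβ L n (g ∘ fsuc) (g∈β ∘ fsuc)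
    ... | γ , Cγ , γ∈β , g∈γ with ≤-or-∋ (g fzero) γ (Ord-∈ β oβ (g∈β fzero)) (Ord-∈ β oβ γ∈β)
    ...   | inj₁ g₀≤γ =
      let (γ′ , Cγ′ , γ∈γ′ , γ′∈β) = lim γ γ∈β
          oγ′ = Ord-∈ β oβ γ′∈β
      in γ′ , Cγ′ , γ′∈β , λ where
        fzero    → [ (λ p → Ord-trans γ′ γ oγ′ p γ∈γ′) , (λ e → ∈-respˡ γ′ (symₛ e) γ∈γ′) ]′ g₀≤γ
        (fsuc i) → Ord-trans γ′ γ oγ′ (g∈γ i) γ∈γ′
    ...   | inj₂ γ∈g₀ =
      let (γ′ , Cγ′ , g₀∈γ′ , γ′∈β) = lim (g fzero) (g∈β fzero)
          oγ′ = Ord-∈ β oβ γ′∈β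
      in γ′ , Cγ′ , γ′∈β , λ where
        fzero    → g₀∈γ′
        (fsuc i) → Ord-trans γ′ γ oγ′ (g∈γ i) (Ord-trans γ′ (g fzero) oγ′ γ∈g₀ g₀∈γ′)

    -- An element of the hull is generated from finitely many ordinals below β. `C-bound` collects
    -- the bounds obtained for the arguments of a Skolem function into a single one.
    Sk-continuous : ∀ β → IsOrd β → LimitPoint (C S) β → ∀ {x} → Sk S β x →
                    ∃[ γ ] C S γ × γ ∈ β × Sk S γ x
    Sk-continuous β oβ (_ , lim) (base {x} x∈β) =
      let (γ , Cγ , x∈γ , γ∈β) = lim x x∈β in γ , Cγ , γ∈β , base x∈γ
    Sk-continuous β oβ L (skolem φ ρ Skρ v) =
      let ih = λ i → Sk-continuous β oβ L (Skρ i)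
          (γ , Cγ , γ∈β , below) = C-bound β oβ L _ (proj₁ ∘ ih) (λ i → proj₁ (proj₂ (proj₂ (ih i))))
      in γ , Cγ , γ∈β , skolem φ ρ
           (λ i → Sk-mono (λ z z∈ → Ord-trans γ _ (Ord-∈ β oβ γ∈β) z∈ (below i))
                          (proj₂ (proj₂ (proj₂ (ih i))))) v

    SkClosed-limit : ∀ β → β ∈ ω₂ → LimitPoint (C S) β → SkClosed S β
    SkClosed-limit β β∈ω₂ L x = mk⇔
      (λ (Skx , x∈ω₂) →
        let (γ , (_ , cl) , γ∈β , Skγ) = Sk-continuous β oβ L Skx
        in Ord-trans β γ oβ (SkClosed-∈ cl Skγ x∈ω₂) γ∈β)
      (λ x∈β → base x∈β , Ord-trans ω₂ β ω₂-Ord x∈β β∈ω₂)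
      where oβ = ∈ω₂⇒Ord β∈ω₂

    -- If x were unbounded, its enumeration would give a cofinal map from ω to β, although the
    -- cofinality ω₁ is larger than ω.
    countable-bounded : ∀ β x → β ∈ ω₂ → HasCofinality β ω₁ → (∃[ α ] α ∈ β) →
                        Countable x → x ⊆ β → ∃[ γ ] γ ∈ β × x ⊆ γ
    countable-bounded β x β∈ω₂ (_ , cof-least) (α₀ , α₀∈β) ctbl x⊆β with em {∃[ γ ] γ ∈ β × x ⊆ γ}
    ... | yes p = p
    ... | no unbounded = ⊥-elim (∈⇒≱ ω ω₁ ω∈ω₁ (cof-least ω (ω-Ord , record
        { to   = λ (_ , n , _) → value n
        ; cong = λ { {_ , n , e} {_ , m , e′} i≈j →
            ≡.subst (λ k → proj₁ (value n) ≈ proj₁ (value k))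
              (num-injective n m (transₛ (symₛ e) (transₛ i≈j e′))) reflₛ }
        } , cofinal)))
      where
      open Injection ctbl
      Hit : ℕ → Set₁
      Hit n = ∃[ y ] Σ (y ∈ x) λ p → to (y , p) ≡ n
      choose : ∀ {n} → Dec (Hit n) → Σ V (_∈ β)
      choose (yes (y , y∈x , _)) = y , x⊆β y y∈x
      -- The map must be total on ω. Numbers that index no element of x receive the default α₀, and
      -- additional values below β do no harm to cofinality.
      choose (no _)              = α₀ , α₀∈β
      value : ℕ → Σ V (_∈ β)
      value n = choose (em {Hit n})
      value-hit : ∀ y (p : y ∈ x) → y ≈ proj₁ (value (to (y , p)))
      value-hit y p with em {Hit (to (y , p))}
      ... | yes (z , q , eq) = injective {y , p} {z , q} (≡.sym eq)
      ... | no ¬hit          = ⊥-elim (¬hit (y , p , refl))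
      cofinal : ∀ α → α ∈ β → ∃[ i ] α ≤ proj₁ (value (proj₁ (proj₂ i)))
      cofinal α α∈β with em {∃[ y ] y ∈ x × ¬ y ∈ α}
      ... | no none = ⊥-elim (unbounded (α , α∈β , λ y y∈x →
              Dec.decidable-stable (em₀ (y ∈ α)) λ y∉α → none (y , y∈x , y∉α)))
      ... | yes (y , y∈x , y∉α) = (num n , n , reflₛ) ,
              [ (λ p → inj₁ (∈-respʳ (value-hit y y∈x) p))
              , (λ e → inj₂ (transₛ e (value-hit y y∈x))) ]′
              (∉⇒≤ α y (∈ω₂⇒Ord (Ord-trans ω₂ β ω₂-Ord α∈β β∈ω₂))
                       (∈ω₂⇒Ord (Ord-trans ω₂ β ω₂-Ord (x⊆β y y∈x) β∈ω₂)) y∉α)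
        where n = to (y , y∈x)

    -- By thinness, {a ∈ 𝒴 : a ⊆ γ} is a set of size ≤ ω₁ in Sk(β), for γ < β.
    𝒴-bounded⊆Sk : ∀ {β γ} → β ∈ ω₂ → SkClosed S β → γ ∈ β → ∀ a → a ∈ 𝒴 → a ⊆ γ → Sk S β a
    𝒴-bounded⊆Sk {β} {γ} β∈ω₂ cl γ∈β a a∈𝒴 a⊆γ =
      -- Because Sk(β) ∩ ω₂ = β, the enumerating ordinal ν is below β, so all indices are in β.
      let (ν , ν∈β , _ , sub) = Sk-enumeration ω₁ cl SkT HT ω₁∈ω₂ T↪ω₁
      in sub (λ i i∈ν → base (Ord-trans β ν (∈ω₂⇒Ord β∈ω₂) i∈ν ν∈β)) a (T⁺ a a∈𝒴 a⊆γ)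
      where
      γ∈ω₂ : γ ∈ ω₂
      γ∈ω₂ = Ord-trans ω₂ β ω₂-Ord γ∈β β∈ω₂
      -- Thinness counts the sets a ∩ γ. Closure of 𝒴 under initial segments identifies them with
      -- the members of 𝒴 included in γ, which is the description that `SkT` turns into a formula.
      T : V
      T = set (Index 𝒴) λ i → elem 𝒴 i ∩ γ
      T⁺ : ∀ z → z ∈ 𝒴 → z ⊆ γ → z ∈ T
      T⁺ z (i , e) z⊆γ = i , transₛ
        (≈-ext z (z ∩ γ) (λ w w∈z → ∩⁺ z γ w∈z (z⊆γ w w∈z)) (λ w → ∩⁻ˡ z γ)) (∩-cong z _ γ e)
      T⊆𝒴 : T ⊆ 𝒴
      T⊆𝒴 z (i , e) = ∈-respˡ 𝒴 (symₛ e) (𝒴-closed _ γ (elem∈ 𝒴 i) γ∈ω₂)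
      T-⊆γ : ∀ z → z ∈ T → z ⊆ γ
      T-⊆γ z (i , e) w w∈z = ∩⁻ʳ (elem 𝒴 i) γ (∈-respʳ e w∈z)
      T↪ω₁ : Injection ⟦ _∈ T ⟧ ⟦ _∈ ω₁ ⟧
      T↪ω₁ = Compose.injection (inclusion λ z (i , e) → elem 𝒴 i , elem∈ 𝒴 i , e) (𝒴-thin γ γ∈ω₂)
      HT : H ω₂ T
      HT = ≼ω₁⇒H (≼ω₁-∪
        (λ _ → trcl-induction (λ y → y ∈ T ⊎ y ∈ γ) (λ _ → inj₁) λ y z y∈z → λ where
          (inj₁ z∈T) → inj₂ (T-⊆γ z z∈T y y∈z)
          (inj₂ z∈γ) → inj₂ (Ord-trans γ z (∈ω₂⇒Ord γ∈ω₂) y∈z z∈γ))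
        (∈-injection⇒≼ T ω₁ T↪ω₁) (∈ω₂⇒≼ω₁ γ γ∈ω₂))
      SkT : Sk S β T
      SkT = Sk-comprehension (𝒴' 0F ∧' (∀'[ 0F ∈' 1F ] (0F ∈' 3F))) (γ ◂ []) T HT
        (λ _ z _ z∈T → lift (T⊆𝒴 z z∈T) , ∀-intro (λ w _ w∈z → lift (T-⊆γ z z∈T w (lower w∈z))))
        (λ _ z Hz (lift z∈𝒴 , h) → T⁺ z z∈𝒴 λ w w∈z → lower (∀-elim h w (H-∈ w∈z Hz) (lift w∈z)))
        (λ { 0F → base γ∈β })

    π-code∈ : ∀ {b x α} (p : α ∈ ω₂) → SkClosed S b → Sk S b x → π[_] S (α , p) ≈ x → α ∈ b
    π-code∈ {b} {x} {α} p cl Skx e =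
      let (α′ , _ , lift (p′ , e′) , Skα′) = skolem-witness (π'[ 0F ]≈ 1F) (x ◂ [])
            (α , H-∈ω₂ p , lift (p , e))
      in ∈-respˡ b (Bijection.injective π {α′ , p′} {α , p} (transₛ e′ (symₛ e)))
           (SkClosed-∈ cl (Skα′ b λ { 0F → Skx }) p′)

    π-value∈ : ∀ {b x α} (p : α ∈ ω₂) → α ∈ b → π[_] S (α , p) ≈ x → Sk S b x
    π-value∈ {b} {x} {α} p α∈b e =
      let (x′ , _ , lift (p′ , e′) , Skx′) = skolem-witness (π'[ 1F ]≈ 0F) (α ◂ [])
            (π[_] S (α , p) , proj₂ (Bijection.to π (α , p)) , lift (p , reflₛ))
      in Sk-resp (transₛ (symₛ e′) (transₛ (Bijection.cong π {α , p′} {α , p} reflₛ) e))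
           (Skx′ b λ { 0F → base α∈b })

    -- Lying in Sk(N) and in Sk(β) does not by itself give membership in Sk(N ∩ β). The detour
    -- through the π-code helps because N and β are exactly the ordinals below ω₂ in their hulls.
    Sk-initialSegment : ∀ β x N → Λ S β → SkClosed S N → x ∈ 𝒴 → Sk S N x → x ⊆ N →
                        Sk S (N ∩ β) (x ∩ β)
    Sk-initialSegment β x N (β∈ω₂ , cof , L) clN x∈𝒴 Skx x⊆N =
      let x∩β∈𝒴 = 𝒴-closed x β x∈𝒴 β∈ω₂
          (x⊆ω₂ , _) = 𝒴⊆Pω₁ω₂ x x∈𝒴
          (_ , ctbl) = 𝒴⊆Pω₁ω₂ (x ∩ β) x∩β∈𝒴
          clβ = SkClosed-limit β β∈ω₂ L
          (γ , γ∈β , x∩β⊆γ) = countable-bounded β (x ∩ β) β∈ω₂ cof (proj₁ L) ctbl (λ _ → ∩⁻ʳ x β)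
          Skβ = 𝒴-bounded⊆Sk β∈ω₂ clβ γ∈β (x ∩ β) x∩β∈𝒴 x∩β⊆γ
          SkN = Sk-∩ x β Skx (Sk⇒H (SkClosed-⊆ω₂ clN) Skx) x⊆ω₂ x⊆N (∈ω₂⇒Ord β∈ω₂)
          (α , p , e) = π-surjective (Sk⇒H (SkClosed-⊆ω₂ clβ) Skβ)
      in π-value∈ p (∩⁺ N β (π-code∈ p clN SkN e) (π-code∈ p clβ Skβ e)) e

    -- Comparison points

    module Comparing (Γ : V) (Γ⊆Λ : ∀ β → β ∈ Γ → Λ S β) where

      Γ-Ord : ∀ {β} → β ∈ Γ → IsOrd β
      Γ-Ord β∈Γ = ∈ω₂⇒Ord (proj₁ (Γ⊆Λ _ β∈Γ))

      -- Γ_M without suprema: no element of Γ below β bounds M ∩ β.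
      Tight : V → V → Set₁
      Tight M β = β ∈ Γ × (∀ ε → ε ∈ Γ → ε ∈ β → ∃[ x ] x ∈ M × x ∈ β × ε ∈ x)

      -- If no element of M ∩ β were above ε, then ε would bound M ∩ β, so ε would be an element of
      -- Γ outside the supremum and smaller than β.
      InΓ⇒Tight : ∀ M β → M ⊆ ω₂ → InΓ S Γ M β → Tight M β
      InΓ⇒Tight M β M⊆ω₂ (σ , ((oσ , _) , σ-least) , (β∈Γ , _) , β-least) = β∈Γ , above
        where
        above : ∀ ε → ε ∈ Γ → ε ∈ β → ∃[ x ] x ∈ M × x ∈ β × ε ∈ x
        above ε ε∈Γ ε∈β with em {∃[ x ] x ∈ M × x ∈ β × ε ∈ x}
        ... | yes p = p
        ... | no none = ⊥-elim (∈⇒≱ ε β ε∈β (β-least ε (ε∈Γ , λ ε∈σ → ∈⇒≱ ε σ ε∈σ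
                (σ-least ε (Γ-Ord ε∈Γ , λ x x∈ → ∉⇒≤ x ε (∈ω₂⇒Ord (M⊆ω₂ x (∩⁻ˡ M β x∈))) (Γ-Ord ε∈Γ)
                  λ ε∈x → none (x , ∩⁻ˡ M β x∈ , ∩⁻ʳ M β x∈ , ε∈x))))))

      -- The ordinal β bounds M ∩ β, so the supremum exists and is at most β. The witness above a
      -- smaller γ in Γ puts γ below the supremum.
      Tight⇒InΓ : ∀ M β → Tight M β → InΓ S Γ M β
      Tight⇒InΓ M β (β∈Γ , above) =
        let (σ , (oσ , bound) , σ-least) = least (λ τ → IsOrd τ × (∀ δ → δ ∈ M ∩ β → δ ≤ τ))
              (λ _ → proj₁) β β-bounds
        in σ , ((oσ , bound) , σ-least) , (β∈Γ , λ β∈σ → ∈⇒≱ β σ β∈σ (σ-least β β-bounds)) ,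
           λ γ (γ∈Γ , γ∉σ) → ∉⇒≤ β γ oβ (Γ-Ord γ∈Γ) λ γ∈β →
             let (x , x∈M , x∈β , γ∈x) = above γ γ∈Γ γ∈β
             in γ∉σ (∈≤-trans γ x σ oσ γ∈x (bound x (∩⁺ M β x∈M x∈β)))
        where
        oβ = Γ-Ord β∈Γ
        β-bounds : IsOrd β × (∀ δ → δ ∈ M ∩ β → δ ≤ β)
        β-bounds = oβ , λ δ δ∈ → inj₁ (∩⁻ʳ M β δ∈)

      IsTightPoint : V → V → V → Set₁
      IsTightPoint M N = IsGreatest (λ β → Tight M β × Tight N β)

      comparison⇒tight : ∀ M N β → M ⊆ ω₂ → N ⊆ ω₂ → IsComparisonPoint S Γ M N β → IsTightPoint M N β
      comparison⇒tight M N β M⊆ N⊆ ((p , q) , greatest) =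
        (InΓ⇒Tight M β M⊆ p , InΓ⇒Tight N β N⊆ q) ,
        λ γ (r , s) → greatest γ (Tight⇒InΓ M γ r , Tight⇒InΓ N γ s)

      tight⇒comparison : ∀ M N β → M ⊆ ω₂ → N ⊆ ω₂ → IsTightPoint M N β → IsComparisonPoint S Γ M N β
      tight⇒comparison M N β M⊆ N⊆ ((p , q) , greatest) =
        (Tight⇒InΓ M β p , Tight⇒InΓ N β q) ,
        λ γ (r , s) → greatest γ (InΓ⇒Tight M γ M⊆ r , InΓ⇒Tight N γ N⊆ s)

      -- Witnesses persist in a larger set. This is applied to K ⊆ N and to M ∩ β ⊆ M.
      Tight-mono : ∀ K N {β} → K ⊆ N → Tight K β → Tight N β
      Tight-mono K N K⊆N (β∈Γ , above) = β∈Γ , λ ε ε∈Γ ε∈β →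
        let (x , x∈K , r) = above ε ε∈Γ ε∈β in x , K⊆N x x∈K , r

      Tight-∩⁺ : ∀ M β γ → β ∈ Γ → γ ≤ β → Tight M γ → Tight (M ∩ β) γ
      Tight-∩⁺ M β γ β∈Γ γ≤β (γ∈Γ , above) = γ∈Γ , λ ε ε∈Γ ε∈γ →
        let (x , x∈M , x∈γ , ε∈x) = above ε ε∈Γ ε∈γ
        in x , ∩⁺ M β x∈M (∈≤-trans x γ β (Γ-Ord β∈Γ) x∈γ γ≤β) , x∈γ , ε∈x

      -- A tight point γ above β would require, at ε = β, an element of M ∩ β above β.
      Tight-∩⇒≤ : ∀ M β γ → β ∈ Γ → Tight (M ∩ β) γ → γ ≤ β
      Tight-∩⇒≤ M β γ β∈Γ (γ∈Γ , above) = ∉⇒≤ γ β (Γ-Ord γ∈Γ) (Γ-Ord β∈Γ) λ β∈γ →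
        let (x , x∈ , _ , β∈x) = above β β∈Γ β∈γ in ∈-asym x β (∩⁻ʳ M β x∈) β∈x

      -- The least upper bound in Γ of the common tight points is itself tight.
      tightPoint-exists : ∀ K M β → β ∈ Γ → (∀ γ → Tight K γ → Tight M γ → γ ≤ β) →
                          ∃[ δ ] IsTightPoint K M δ
      tightPoint-exists K M β β∈Γ bounded with
        least (λ δ → δ ∈ Γ × (∀ γ → Tight K γ → Tight M γ → γ ≤ δ)) (λ _ → Γ-Ord ∘ proj₁) β (β∈Γ , bounded)
      ... | δ , (δ∈Γ , upper) , δ-least with em {Tight K δ × Tight M δ}
      ...   | yes p = δ , p , λ γ (r , s) → upper γ r s
      -- All common tight points are now strictly below δ, and by leastness of δ each ε in Γ below δ
      -- has one of them above it. The witness for ε at that point is also a witness at δ, so δ is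
      -- tight for both sets after all.
      ...   | no ¬p = ⊥-elim (¬p
                ( (δ∈Γ , λ ε ε∈Γ ε∈δ → let (γ , t , _ , r) = between ε ε∈Γ ε∈δ in above K γ ε t ε∈Γ r)
                , (δ∈Γ , λ ε ε∈Γ ε∈δ → let (γ , _ , t , r) = between ε ε∈Γ ε∈δ in above M γ ε t ε∈Γ r)))
        where
        below : ∀ γ → Tight K γ → Tight M γ → γ ∈ δ
        below γ r s with upper γ r s
        ... | inj₁ γ∈δ = γ∈δ
        ... | inj₂ γ≈δ = ⊥-elim (¬p (Tight-resp K γ≈δ r , Tight-resp M γ≈δ s))
          where
          Tight-resp : ∀ M {γ δ} → γ ≈ δ → Tight M γ → Tight M δ
          Tight-resp M e (γ∈Γ , above) = ∈-respˡ Γ e γ∈Γ , λ ε ε∈Γ ε∈δ →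
            let (x , x∈M , x∈γ , ε∈x) = above ε ε∈Γ (∈-respʳ (symₛ e) ε∈δ)
            in x , x∈M , ∈-respʳ e x∈γ , ε∈x
        between : ∀ ε → ε ∈ Γ → ε ∈ δ → ∃[ γ ] Tight K γ × Tight M γ × ε ∈ γ × γ ∈ δ
        between ε ε∈Γ ε∈δ with em {∃[ γ ] Tight K γ × Tight M γ × ε ∈ γ × γ ∈ δ}
        ... | yes p = p
        ... | no none = ⊥-elim (∈⇒≱ ε δ ε∈δ (δ-least ε (ε∈Γ , λ γ r s →
                ∉⇒≤ γ ε (Γ-Ord (proj₁ r)) (Γ-Ord ε∈Γ) λ ε∈γ → none (γ , r , s , ε∈γ , below γ r s))))
        above : ∀ M γ ε → Tight M γ → ε ∈ Γ → ε ∈ γ × γ ∈ δ → ∃[ x ] x ∈ M × x ∈ δ × ε ∈ x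
        above M γ ε (_ , ab) ε∈Γ (ε∈γ , γ∈δ) =
          let (x , x∈M , x∈γ , ε∈x) = ab ε ε∈Γ ε∈γ
          in x , x∈M , Ord-trans δ γ (Γ-Ord δ∈Γ) x∈γ γ∈δ , ε∈x

      ∩-∩ : ∀ x β δ → IsOrd β → δ ≤ β → (x ∩ β) ∩ δ ≈ x ∩ δ
      ∩-∩ x β δ oβ δ≤β = ≈-ext ((x ∩ β) ∩ δ) (x ∩ δ)
        (λ z z∈ → ∩⁺ x δ (∩⁻ˡ x β (∩⁻ˡ (x ∩ β) δ z∈)) (∩⁻ʳ (x ∩ β) δ z∈))
        (λ z z∈ → let z∈δ = ∩⁻ʳ x δ z∈
                  in ∩⁺ (x ∩ β) δ (∩⁺ x β (∩⁻ˡ x δ z∈) (∈≤-trans z δ β oβ z∈δ δ≤β)) z∈δ)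

      Compatible : V → V → V → Set₁
      Compatible M N β = M ∩ β ≈ N ∩ β ⊎ Sk S N (M ∩ β) ⊎ Sk S M (N ∩ β)

      Comparable : V → V → Set₁
      Comparable M N = ∃[ β ] IsComparisonPoint S Γ M N β × Compatible M N β

      Comparable-sym : ∀ M N → Comparable M N → Comparable N M
      Comparable-sym M N (β , ((p , q) , greatest) , c) =
        β , ((q , p) , λ γ (r , s) → greatest γ (s , r)) ,
        (case c of λ where
          (inj₁ e)        → inj₁ (symₛ e)
          (inj₂ (inj₁ s)) → inj₂ (inj₂ s)
          (inj₂ (inj₂ s)) → inj₂ (inj₁ s))

      𝒳⇒∈𝒴 : ∀ {M} → 𝒳 S M → M ∈ 𝒴
      𝒳⇒∈𝒴 = proj₁

      𝒳⇒SkClosed : ∀ {M} → 𝒳 S M → SkClosed S M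
      𝒳⇒SkClosed = proj₁ ∘ proj₂

      𝒳⇒⊆ω₂ : ∀ M → 𝒳 S M → M ⊆ ω₂
      𝒳⇒⊆ω₂ M XM = proj₁ (𝒴⊆Pω₁ω₂ M (proj₁ XM))

      Sk-∈𝒴-⊆ : ∀ {M} x → 𝒳 S M → x ∈ 𝒴 → Sk S M x → x ⊆ M
      Sk-∈𝒴-⊆ {M} x XM x∈𝒴 Skx z z∈x =
        let (x⊆ω₂ , ctbl) = 𝒴⊆Pω₁ω₂ x x∈𝒴
            cl = 𝒳⇒SkClosed XM
        in SkClosed-∈ cl (Sk-countable-⊆ cl Skx (Sk⇒H (𝒳⇒⊆ω₂ M XM) Skx) ctbl z z∈x) (x⊆ω₂ z z∈x)

      -- Comparing an element of B with an element of A

      module Amalgamation {K M N β} (XK : 𝒳 S K) (XM : 𝒳 S M) (XN : 𝒳 S N)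
                          (SkK : Sk S N K) (cmp : IsComparisonPoint S Γ M N β) where

        K⊆ω₂ : K ⊆ ω₂
        K⊆ω₂ = 𝒳⇒⊆ω₂ K XK

        M⊆ω₂ : M ⊆ ω₂
        M⊆ω₂ = 𝒳⇒⊆ω₂ M XM

        K⊆N : K ⊆ N
        K⊆N = Sk-∈𝒴-⊆ K XN (𝒳⇒∈𝒴 XK) SkK

        tight : IsTightPoint M N β
        tight = comparison⇒tight M N β M⊆ω₂ (𝒳⇒⊆ω₂ N XN) cmp

        β∈Γ : β ∈ Γ
        β∈Γ = proj₁ (proj₁ (proj₁ tight))

        common≤β : ∀ γ → Tight K γ → Tight M γ → γ ≤ β
        common≤β γ p q = proj₂ tight γ (q , Tight-mono K N K⊆N p)

        comparable-⊆ : N ∩ β ⊆ M → Comparable K M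
        comparable-⊆ N∩β⊆M =
          let (δ , tδ) = tightPoint-exists K M β β∈Γ common≤β
              ((p , q) , _) = tδ
              β∈ω₂ = proj₁ (Γ⊆Λ β β∈Γ)
              K∩β∈𝒴 = 𝒴-closed K β (𝒳⇒∈𝒴 XK) β∈ω₂
              SkM = Sk-mono N∩β⊆M
                (Sk-initialSegment β K N (Γ⊆Λ β β∈Γ) (𝒳⇒SkClosed XN) (𝒳⇒∈𝒴 XK) SkK K⊆N)
              -- δ need not belong to Sk(M); `Sk-∩` cuts K ∩ β at one of its own elements instead.
              SkM′ = Sk-∩ (K ∩ β) δ SkM (Sk⇒H M⊆ω₂ SkM) (proj₁ (𝒴⊆Pω₁ω₂ (K ∩ β) K∩β∈𝒴))
                (Sk-∈𝒴-⊆ (K ∩ β) XM K∩β∈𝒴 SkM) (Γ-Ord (proj₁ p))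
          in δ , tight⇒comparison K M δ K⊆ω₂ M⊆ω₂ tδ ,
             inj₂ (inj₁ (Sk-resp (∩-∩ K β δ (Γ-Ord β∈Γ) (common≤β δ p q)) SkM′))

        -- Since δ ≤ β, M ∩ β and M have the same intersection with δ, and Sk(M ∩ β) is included in
        -- Sk(M). Hence each of the three alternatives carries over.
        comparable-∩ : Comparable K (M ∩ β) → Comparable K M
        comparable-∩ (δ , cmpδ , c) =
          let ((p , q) , greatest) = comparison⇒tight K (M ∩ β) δ K⊆ω₂
                (λ z → M⊆ω₂ z ∘ ∩⁻ˡ M β) cmpδ
              e = ∩-∩ M β δ (Γ-Ord β∈Γ) (Tight-∩⇒≤ M β δ β∈Γ q)
          in δ
           , tight⇒comparison K M δ K⊆ω₂ M⊆ω₂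
               ( (p , Tight-mono (M ∩ β) M (λ _ → ∩⁻ˡ M β) q)
               , λ γ (r , s) → greatest γ (r , Tight-∩⁺ M β γ β∈Γ (common≤β γ r s) s))
           , (case c of λ where
               (inj₁ e′)       → inj₁ (transₛ e′ e)
               (inj₂ (inj₁ s)) → inj₂ (inj₁ (Sk-mono (λ _ → ∩⁻ˡ M β) s))
               (inj₂ (inj₂ s)) → inj₂ (inj₂ (Sk-resp e s)))

      Adequate-∪ : (A N : V) → Adequate S Γ A → N ∈ A → Closed S Γ N A →
        (B : V) → Adequate S Γ B →
        (∀ M → M ∈ A → Sk S N M → M ∈ B) → (∀ M → M ∈ B → Sk S N M) →
        Adequate S Γ (A ∪ B)
      Adequate-∪ A N (XA , cA) N∈A closed B (XB , cB) A∩Sk⊆B B⊆Sk =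
        (λ M M∈ → [ XA M , XB M ]′ (∪⁻ A B M∈)) , comparable
        where
        mixed : ∀ K M → K ∈ B → M ∈ A → Comparable K M
        mixed K M K∈B M∈A with cA M N M∈A N∈A
        ... | β , cmp , c = case c of λ where
            (inj₁ M∩β≈N∩β)  → comparable-⊆ λ z z∈ → ∩⁻ˡ M β (∈-respʳ (symₛ M∩β≈N∩β) z∈)
            (inj₂ (inj₁ s)) → comparable-∩
              (cB K (M ∩ β) K∈B (A∩Sk⊆B (M ∩ β) (closed M β M∈A cmp s) s))
            (inj₂ (inj₂ s)) → comparable-⊆ (Sk-∈𝒴-⊆ (N ∩ β) (XA M M∈A)
              (𝒴-closed N β (𝒳⇒∈𝒴 (XA N N∈A)) (proj₁ (Γ⊆Λ β β∈Γ))) s)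
          where open Amalgamation (XB K K∈B) (XA M M∈A) (XA N N∈A) (B⊆Sk K K∈B) cmp
        comparable : ∀ M M′ → M ∈ A ∪ B → M′ ∈ A ∪ B → Comparable M M′
        comparable M M′ p q with ∪⁻ A B p | ∪⁻ A B q
        ... | inj₁ M∈A | inj₁ M′∈A = cA M M′ M∈A M′∈A
        ... | inj₂ M∈B | inj₂ M′∈B = cB M M′ M∈B M′∈B
        ... | inj₂ M∈B | inj₁ M′∈A = mixed M M′ M∈B M′∈A
        ... | inj₁ M∈A | inj₂ M′∈B = Comparable-sym M′ M (mixed M′ M M′∈B M∈A)

open Setting using (ω₂)

proposition3p9 : ExcludedMiddle (suc 0ℓ) → AxiomOfChoice →
    (S : Setting) (Γ : V) → (∀ β → β ∈ Γ → Λ S β) → IsStationary (ω₂ S) Γ →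
    (A N : V) → Adequate S Γ A → N ∈ A → Closed S Γ N A →
    (B : V) → Adequate S Γ B →
    (∀ M → M ∈ A → Sk S N M → M ∈ B) → (∀ M → M ∈ B → Sk S N M) →
    Adequate S Γ (A ∪ B)
proposition3p9 em _ S Γ Γ⊆Λ _ = Adequate-∪
  where open Classical.InSetting.Comparing em S Γ Γ⊆Λ
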